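{- Let $B_n(t)=\sum_{k=0}^n\binom nk^2t^k$ be the Narayana polynomials of type $B$ and $L_n(x,s)$ the Lucas polynomials. Then for all integers $n\ge 1$, as polynomials in $t$, $$\det\bigl(B_{i+j}(t)+B_{i+j+1}(t)\bigr)_{i,j=0}^{n-1}=(-1)^n\,t^{\binom n2}\,2^{n-1}\,L_n(-t-2,-t).$$
   Context: The Lucas polynomials are defined by $L_0(x,s)=2$, $L_1(x,s)=x$, $L_n(x,s)=xL_{n-1}(x,s)+sL_{n-2}(x,s)$ for $n\ge 2$. -}

module Defs where

open import Algebra.Bundles.Raw using (RawRing)
open import Algebra.Definitions.RawSemiring as RawSemiringDefs using ()
open import Data.Fin.Base using (Fin; zero; suc; toℕ; punchIn)
open import Data.Integer.Base as ℤ using (ℤ)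
open import Data.List.Base using (List; []; _∷_; map)
open import Data.Nat.Base as ℕ using (ℕ; zero; suc)
open import Data.Nat.Combinatorics using (_C_)
open import Level using (0ℓ)
open import Relation.Binary.PropositionalEquality.Core using (_≡_)

-- The definitions below are only meant for raw rings that are commutative
-- rings; no laws are needed to state them.
module RingOps {c ℓ} (R : RawRing c ℓ) where

  open RawRing R public
    using (Carrier; _≈_; _+_; _*_; -_; 0#; 1#)
  open RawSemiringDefs (RawRing.rawSemiring R) public
    using (_×_; _^_; sum)

  infixl 6 _-_
  _-_ : Carrier → Carrier → Carrier
  x - y = x + (- y)

  -- Cofactor expansion along the first row; punchIn j enumerates the columns
  -- other than j in increasing order.
  det : ∀ n → (Fin n → Fin n → Carrier) → Carrier
  det zero    M = 1#
  det (suc n) M =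
    sum λ j → ((- 1#) ^ toℕ j) * M zero j * det n (λ i k → M (suc i) (punchIn j k))

  lucas : ℕ → Carrier → Carrier → Carrier
  lucas 0             x s = 2 × 1#
  lucas 1             x s = x
  lucas (suc (suc n)) x s = x * lucas (suc n) x s + s * lucas n x s

  -- k ranges over Fin (suc n), that is, 0 ≤ k ≤ n.
  narayanaB : ℕ → Carrier → Carrier
  narayanaB n t = sum {suc n} λ k → ((n C toℕ k) ℕ.^ 2) × (t ^ toℕ k)

-- A polynomial with integer coefficients is the list of its coefficients,
-- constant term first. Trailing zeros are allowed, so equality of polynomials
-- is equality of all coefficients rather than of lists.
Poly : Set
Poly = List ℤ

coeff : Poly → ℕ → ℤ
coeff []      k       = ℤ.0ℤ
coeff (a ∷ p) zero    = a
coeff (a ∷ p) (suc k) = coeff p k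

infix 4 _≈ₚ_
_≈ₚ_ : Poly → Poly → Set
p ≈ₚ q = ∀ k → coeff p k ≡ coeff q k

infixl 6 _+ₚ_
_+ₚ_ : Poly → Poly → Poly
[]      +ₚ q       = q
(a ∷ p) +ₚ []      = a ∷ p
(a ∷ p) +ₚ (b ∷ q) = (a ℤ.+ b) ∷ (p +ₚ q)

-- (a + t p) q = a q + t (p q)
infixl 7 _*ₚ_
_*ₚ_ : Poly → Poly → Poly
[]      *ₚ q = []
(a ∷ p) *ₚ q = map (a ℤ.*_) q +ₚ (ℤ.0ℤ ∷ (p *ₚ q))

ℤ[t] : RawRing 0ℓ 0ℓ
ℤ[t] = record
  { Carrier = Poly
  ; _≈_     = _≈ₚ_
  ; _+_     = _+ₚ_
  ; _*_     = _*ₚ_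
  ; -_      = map (ℤ.-_)
  ; 0#      = []
  ; 1#      = ℤ.1ℤ ∷ []
  }

t : Poly
t = ℤ.0ℤ ∷ ℤ.1ℤ ∷ []

{-# OPTIONS --safe #-}

-- Bₙ(t) is the constant term of fₙ = ((1 + x)(1 + t/x))ⁿ. Let a(n,k) be the coefficient of xᵏ in fₙ,
-- for k ≥ 0. The coefficient of x⁻ᵏ is tᵏ a(n,k), so multiplication by (1 + x)(1 + t/x) acts on the
-- rows of a by a tridiagonal matrix J with diagonal 1 + t, subdiagonal 1 and superdiagonal 2t, t, t, ….
-- With the weights D = diag(1, 2t, 2t², …), for which J is self-adjoint, B_{i+j} = Σₖ a(i,k) Dₖ a(j,k),
-- and therefore (B_{i+j} + B_{i+j+1}) = A D (1 + J) Aᵀ with A = (a(i,k)) unitriangular. Here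
-- det D = 2ⁿ⁻¹ t^C(n,2), and det (1 + J) satisfies the recurrence of (-1)ⁿ Lₙ(-t-2, -t).
--
-- The determinant is multiplicative and invariant under transposition because it is the only alternating
-- multilinear function of the rows up to a scalar; for det Mᵀ, alternation is visible from the expansion.

module Submission where

open import Defs
open import Algebra.Bundles using (CommutativeRing; Semiring)
import Algebra.Definitions.RawSemiring
import Algebra.Properties.Monoid.Sum
import Algebra.Properties.Ring
import Algebra.Properties.Semiring.Exp
import Algebra.Properties.Semiring.Mult
import Algebra.Properties.Semiring.Sum
import Algebra.Solver.Ring.NaturalCoefficients.Default
open import Data.Empty using (⊥-elim)
open import Data.Fin.Base using (Fin; zero; suc; toℕ; fromℕ; punchIn; punchOut; inject₁)
open import Data.Fin.Induction using (<-weakInduction)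
open import Data.Fin.Properties using
  (_≟_; punchInᵢ≢i; punchIn-injective; punchIn-punchOut; suc-injective; toℕ<n; toℕ-inject₁; toℕ-fromℕ)
open import Data.Integer.Base as ℤ using ()
import Data.Integer.Properties as ℤ
import Data.Integer.Solver as ℤ-Solver
open import Data.List.Base as List using ()
open import Data.Nat.Base as ℕ using (ℕ; zero; suc; _≤_; _<_; _∸_; z≤n; s≤s)
open import Data.Nat.Combinatorics using (_C_; nCn≡1; nC1≡n; k>n⇒nCk≡0; nCk+nC[k+1]≡[n+1]C[k+1])
import Data.Nat.Properties as ℕ
open import Data.Product.Base as Product using (_,_; ∃₂)
open import Data.Sum.Base as Sum using (_⊎_; inj₁; inj₂)
open import Data.Vec.Functional as Vector using (Vector; tail; insertAt; removeAt; updateAt)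
open import Data.Vec.Functional.Properties using (updateAt-updates; updateAt-minimal)
import Data.Vec.Functional.Relation.Binary.Equality.Setoid
open import Function.Base using (_∘_; const; flip)
open import Level using (0ℓ; _⊔_)
open import Relation.Binary.PropositionalEquality as ≡ using (_≡_; _≢_; module ≡-Reasoning)
import Relation.Binary.Reasoning.Setoid
open import Relation.Nullary.Decidable.Core using (yes; no)

-- Adjacent indices and the deletion of an index.

data Adjacent : ∀ {n} → Fin n → Fin n → Set where
  here  : ∀ {n} → Adjacent {suc (suc n)} zero (suc zero)
  there : ∀ {n} {i j : Fin n} → Adjacent i j → Adjacent (suc i) (suc j)

adjacent-inject₁ : ∀ {n} (i : Fin n) → Adjacent (inject₁ i) (suc i)
adjacent-inject₁ zero    = here
adjacent-inject₁ (suc i) = there (adjacent-inject₁ i)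

toℕ-adjacent : ∀ {n} {p q : Fin n} → Adjacent p q → toℕ q ≡ suc (toℕ p)
toℕ-adjacent here      = ≡.refl
toℕ-adjacent (there a) = ≡.cong suc (toℕ-adjacent a)

adjacent⇒≢ : ∀ {n} {p q : Fin n} → Adjacent p q → p ≢ q
adjacent⇒≢ (there a) eq = adjacent⇒≢ a (suc-injective eq)

-- The columns left after deleting `p` and those left after deleting `q` differ in one place only,
-- where the other of the two survives. Hence the two minors agree when columns `p` and `q` are
-- equal.
punchIn-adjacent : ∀ {n} {p q : Fin (suc n)} → Adjacent p q → ∀ k →
  punchIn p k ≡ punchIn q k ⊎ (punchIn p k ≡ q Product.× punchIn q k ≡ p)
punchIn-adjacent here      zero    = inj₂ (≡.refl , ≡.refl)
punchIn-adjacent here      (suc k) = inj₁ ≡.refl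
punchIn-adjacent (there a) zero    = inj₁ ≡.refl
punchIn-adjacent (there a) (suc k) =
  Sum.map (≡.cong suc) (λ (e , f) → ≡.cong suc e , ≡.cong suc f) (punchIn-adjacent a k)

-- Deleting a third index opens no gap between `p` and `q`, so a minor without column `j` still has
-- two adjacent equal columns and induction on the size applies.
adjacent-punchIn⁻¹ : ∀ {n} {p q : Fin (suc n)} (j : Fin (suc n)) → Adjacent p q → j ≢ p → j ≢ q →
  ∃₂ λ p′ q′ → Adjacent p′ q′ Product.× punchIn j p′ ≡ p Product.× punchIn j q′ ≡ q
adjacent-punchIn⁻¹ zero          here      j≢p j≢q = ⊥-elim (j≢p ≡.refl)
adjacent-punchIn⁻¹ zero          (there a) j≢p j≢q = _ , _ , a , ≡.refl , ≡.refl
adjacent-punchIn⁻¹ (suc zero)    here      j≢p j≢q = ⊥-elim (j≢q ≡.refl)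
adjacent-punchIn⁻¹ {suc (suc n)} (suc (suc j)) here j≢p j≢q =
  zero , suc zero , here , ≡.refl , ≡.refl
adjacent-punchIn⁻¹ {suc n} (suc j) (there a) j≢p j≢q
  with p′ , q′ , a′ , e , f ← adjacent-punchIn⁻¹ j a (j≢p ∘ ≡.cong suc) (j≢q ∘ ≡.cong suc)
  = suc p′ , suc q′ , there a′ , ≡.cong suc e , ≡.cong suc f

module Determinant {c ℓ} (R : CommutativeRing c ℓ) where

  open CommutativeRing R hiding (zero)
  open RingOps rawRing using (det)
  open Vector using (_∷_)
  open Algebra.Properties.Ring ring using (-1*x≈-x; +-inverseˡ-unique)
  open Algebra.Properties.Semiring.Exp semiring using (_^_)
  open Algebra.Properties.Semiring.Sum semiring
  open Algebra.Definitions.RawSemiring (Semiring.rawSemiring semiring) using (product)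
  open Algebra.Solver.Ring.NaturalCoefficients.Default commutativeSemiring
  open Data.Vec.Functional.Relation.Binary.Equality.Setoid setoid using (_≋_; ≋-refl; ≋-sym; ≋-trans; ≋-reflexive)
  open Relation.Binary.Reasoning.Setoid setoid

  -- Alternating multilinear functions of the rows.

  Matrix : ℕ → ℕ → Set c
  Matrix m n = Vector (Vector Carrier n) m

  -- Linearity in row `i` is a relation between three matrices that agree elsewhere, which keeps row
  -- updates out of the law. Additivity and homogeneity form one equation; `cong` makes `F` respect
  -- pointwise equality of rows.
  record Multilinear {m n} (F : Matrix m n → Carrier) : Set (c ⊔ ℓ) where
    field
      cong   : ∀ {M N} → (∀ i → M i ≋ N i) → F M ≈ F N
      linear : ∀ i a {M N P} → (P i ≋ λ j → a * M i j + N i j) →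
               (∀ k → k ≢ i → M k ≋ P k) → (∀ k → k ≢ i → N k ≋ P k) →
               F P ≈ a * F M + F N

  -- Only adjacent equal rows are tested, because this weak form is what the cofactor expansion
  -- yields directly. `vanish-first` extends it to the first row paired with any other.
  Alternating : ∀ {m n} → (Matrix m n → Carrier) → Set (c ⊔ ℓ)
  Alternating F = ∀ {p q} → Adjacent p q → ∀ {M} → M p ≋ M q → F M ≈ 0#

  fixFirst : ∀ {m n} {F : Matrix (suc m) n → Carrier} → Multilinear F →
             ∀ r → Multilinear (λ M → F (r ∷ M))
  fixFirst lin r = record
    { cong   = λ eq → cong λ { zero → ≋-refl ; (suc i) → eq i }
    ; linear = λ i a eq off₁ off₂ → linear (suc i) a eq
        (λ { zero _ → ≋-refl ; (suc k) k≢ → off₁ k (k≢ ∘ ≡.cong suc) })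
        (λ { zero _ → ≋-refl ; (suc k) k≢ → off₂ k (k≢ ∘ ≡.cong suc) })
    } where open Multilinear lin

  unit : ∀ {n} → Matrix n n
  unit zero    zero    = 1#
  unit zero    (suc j) = 0#
  unit (suc i) zero    = 0#
  unit (suc i) (suc j) = unit i j

  expandForm : ∀ {n} (L : Vector Carrier n → Carrier) →
    (∀ {u v} → u ≋ v → L u ≈ L v) →
    (∀ a {u v w} → (w ≋ λ j → a * u j + v j) → L w ≈ a * L u + L v) →
    ∀ r → L r ≈ ∑[ j < n ] (r j * L (unit j))
  expandForm {zero} L cong linear r = begin
    -- In dimension zero all vectors are equal, so linearity with scalar -1 applies to three copies
    -- of `r`.
    L r                 ≈⟨ linear (- 1#) (λ ()) ⟩
    - 1# * L r + L r    ≈⟨ +-congʳ (-1*x≈-x _) ⟩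
    - L r + L r         ≈⟨ -‿inverseˡ _ ⟩
    0#                  ∎
  expandForm {suc n} L cong linear r = begin
    L r
      ≈⟨ linear (r zero) (λ { zero    → solve 1 (λ x → x := x :* con 1 :+ con 0) refl (r zero)
                            ; (suc j) → solve 2 (λ x y → y := x :* con 0 :+ y) refl (r zero) (r (suc j)) }) ⟩
    r zero * L (unit zero) + L (0# ∷ tail r)
      ≈⟨ +-congˡ (expandForm (λ u → L (0# ∷ u))
           (λ eq → cong λ { zero → refl ; (suc j) → eq j })
           (λ a eq → linear a λ { zero → solve 1 (λ x → con 0 := x :* con 0 :+ con 0) refl a ; (suc j) → eq j })
           (tail r)) ⟩
    r zero * L (unit zero) + ∑[ j < n ] (r (suc j) * L (0# ∷ unit j))
      ≈⟨ +-congˡ (sum-cong-≋ {n} λ j → *-congˡ (cong λ { zero → refl ; (suc k) → refl })) ⟩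
    r zero * L (unit zero) + ∑[ j < n ] (r (suc j) * L (unit (suc j))) ∎

  -- Rows are treated one at a time from the top: by linearity the multiple of `v` in a row
  -- contributes a multiple of `F` at a matrix with `v` in that row, which is zero. `fixFirst`
  -- freezes the rows already cleared.
  clearMultiples : ∀ {m n} {F : Matrix m n → Carrier} → Multilinear F → ∀ v →
    (∀ i {M} → M i ≋ v → F M ≈ 0#) →
    ∀ (a : Vector Carrier m) {M N} → (∀ i → M i ≋ λ j → a i * v j + N i j) → F M ≈ F N
  clearMultiples {zero}  lin v vanish a eq = Multilinear.cong lin λ ()
  clearMultiples {suc m} {F = F} lin v vanish a {M} {N} eq = begin
    F M
      ≈⟨ linear zero (a zero) {v ∷ tail M} {N zero ∷ tail M} (eq zero) off off ⟩
    a zero * F (v ∷ tail M) + F (N zero ∷ tail M)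
      ≈⟨ +-congʳ (*-congˡ (vanish zero ≋-refl)) ⟩
    a zero * 0# + F (N zero ∷ tail M)
      ≈⟨ solve 2 (λ x y → x :* con 0 :+ y := y) refl _ _ ⟩
    F (N zero ∷ tail M)
      ≈⟨ clearMultiples (fixFirst lin (N zero)) v (λ i → vanish (suc i)) (tail a) (λ i → eq (suc i)) ⟩
    F (N zero ∷ tail N)
      ≈⟨ cong (λ { zero → ≋-refl ; (suc i) → ≋-refl }) ⟩
    F N ∎
    where
    open Multilinear lin
    off : ∀ {r} k → k ≢ zero → (r ∷ tail M) k ≋ M k
    off zero    0≢0 = ⊥-elim (0≢0 ≡.refl)
    off (suc k) _   = ≋-refl

  -- Exchange of two rows.

  module _ {m n} {F : Matrix m n → Carrier} (lin : Multilinear F) {p q : Fin m} (p≢q : p ≢ q)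
           (vanish : ∀ {M} → M p ≋ M q → F M ≈ 0#) (M : Matrix m n) where
    open Multilinear lin

    private
      rows : Vector Carrier n → Vector Carrier n → Matrix m n
      rows x y = updateAt (updateAt M p (const x)) q (const y)

      rows-p : ∀ x y → rows x y p ≋ x
      rows-p x y = ≋-reflexive (≡.trans (updateAt-minimal p q _ p≢q) (updateAt-updates p M))

      rows-q : ∀ x y → rows x y q ≋ y
      rows-q x y = ≋-reflexive (updateAt-updates q (updateAt M p (const x)))

      rows-other : ∀ x y k → k ≢ p → k ≢ q → rows x y k ≋ M k
      rows-other x y k k≢p k≢q =
        ≋-reflexive (≡.trans (updateAt-minimal k q _ k≢q) (updateAt-minimal k p M k≢p))

      F-rows : ∀ {x y N} → N p ≋ x → N q ≋ y → (∀ k → k ≢ p → k ≢ q → N k ≋ M k) → F N ≈ F (rows x y)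
      F-rows {x} {y} ep eq eo = cong λ k → go k (k ≟ p) (k ≟ q)
        where
        go : ∀ k → _ → _ → _
        go k (yes ≡.refl) _            = ≋-trans ep (≋-sym (rows-p x y))
        go k (no _)       (yes ≡.refl) = ≋-trans eq (≋-sym (rows-q x y))
        go k (no k≢p)     (no k≢q)     = ≋-trans (eo k k≢p k≢q) (≋-sym (rows-other x y k k≢p k≢q))

      _⊕_ : Vector Carrier n → Vector Carrier n → Vector Carrier n
      (x ⊕ y) j = x j + y j

      sameExcept-p : ∀ x x′ y k → k ≢ p → rows x y k ≋ rows x′ y k
      sameExcept-p x x′ y k k≢p with k ≟ q
      ... | yes ≡.refl = ≋-trans (rows-q x y) (≋-sym (rows-q x′ y))
      ... | no k≢q     = ≋-trans (rows-other x y k k≢p k≢q) (≋-sym (rows-other x′ y k k≢p k≢q))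

      sameExcept-q : ∀ x y y′ k → k ≢ q → rows x y k ≋ rows x y′ k
      sameExcept-q x y y′ k k≢q with k ≟ p
      ... | yes ≡.refl = ≋-trans (rows-p x y) (≋-sym (rows-p x y′))
      ... | no k≢p     = ≋-trans (rows-other x y k k≢p k≢q) (≋-sym (rows-other x y′ k k≢p k≢q))

      split-p : ∀ x x′ y → F (rows (x ⊕ x′) y) ≈ F (rows x y) + F (rows x′ y)
      split-p x x′ y = trans
        (linear p 1#
          (λ j → trans (rows-p _ y j) (+-cong (trans (sym (rows-p x y j)) (sym (*-identityˡ _))) (sym (rows-p x′ y j))))
          (sameExcept-p x _ y) (sameExcept-p x′ _ y))
        (+-congʳ (*-identityˡ _))

      split-q : ∀ x y y′ → F (rows x (y ⊕ y′)) ≈ F (rows x y) + F (rows x y′)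
      split-q x y y′ = trans
        (linear q 1#
          (λ j → trans (rows-q x _ j) (+-cong (trans (sym (rows-q x y j)) (sym (*-identityˡ _))) (sym (rows-q x y′ j))))
          (sameExcept-q x y _) (sameExcept-q x y′ _))
        (+-congʳ (*-identityˡ _))

      F-equal : ∀ x → F (rows x x) ≈ 0#
      F-equal x = vanish (≋-trans (rows-p x x) (≋-sym (rows-q x x)))

    -- Polarization: `F` vanishes when both rows equal the sum of `M p` and `M q`. Expanding by
    -- linearity in each row leaves only the two mixed terms, so these are negatives of each other.
    swap : ∀ {N} → N p ≋ M q → N q ≋ M p → (∀ k → k ≢ p → k ≢ q → N k ≋ M k) → F N ≈ - F M
    swap {N} ep eq eo = begin
      F N            ≈⟨ F-rows ep eq eo ⟩
      F (rows s r)   ≈⟨ +-inverseˡ-unique _ _ cancel ⟩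
      - F (rows r s) ≈⟨ -‿cong (F-rows ≋-refl ≋-refl λ _ _ _ → ≋-refl) ⟨
      - F M          ∎
      where
      r = M p
      s = M q
      cancel : F (rows s r) + F (rows r s) ≈ 0#
      cancel = begin
        F (rows s r) + F (rows r s)
          ≈⟨ solve 2 (λ x y → x :+ y := (con 0 :+ y) :+ (x :+ con 0)) refl _ _ ⟩
        (0# + F (rows r s)) + (F (rows s r) + 0#)
          ≈⟨ +-cong (+-congʳ (F-equal r)) (+-congˡ (F-equal s)) ⟨
        (F (rows r r) + F (rows r s)) + (F (rows s r) + F (rows s s))
          ≈⟨ +-cong (split-q r r s) (split-q s r s) ⟨
        F (rows r (r ⊕ s)) + F (rows s (r ⊕ s))
          ≈⟨ split-p r s (r ⊕ s) ⟨
        F (rows (r ⊕ s) (r ⊕ s))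
          ≈⟨ F-equal (r ⊕ s) ⟩
        0# ∎

    swapped : Matrix m n
    swapped = rows (M q) (M p)

    F-swapped : F swapped ≈ - F M
    F-swapped = swap (rows-p _ _) (rows-q _ _) (rows-other _ _)

    swapped-p : swapped p ≋ M q
    swapped-p = rows-p _ _

    swapped-other : ∀ k → k ≢ p → k ≢ q → swapped k ≋ M k
    swapped-other = rows-other _ _

  -- Swapping adjacent rows moves the row equal to the first one step up and changes only the sign
  -- of `F`. The induction ends at the first two rows, which are adjacent.
  vanish-first : ∀ {m n} {F : Matrix (suc m) n → Carrier} → Multilinear F → Alternating F →
    ∀ i {M} → M zero ≋ M (suc i) → F M ≈ 0#
  vanish-first {suc m} {F = F} lin alt = <-weakInduction _ (alt here) step
    where
    step : ∀ i → (∀ {M} → M zero ≋ M (suc (inject₁ i)) → F M ≈ 0#) →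
           ∀ {M} → M zero ≋ M (suc (suc i)) → F M ≈ 0#
    step i ih {M} eq = begin
      F M                               ≈⟨ +-identityʳ _ ⟨
      F M + 0#                          ≈⟨ +-congˡ (ih (≋-trans (swapped-other lin p≢q (alt adj) M zero (λ ()) λ ())
                                            (≋-trans eq (≋-sym (swapped-p lin p≢q (alt adj) M))))) ⟨
      F M + F (swapped lin p≢q (alt adj) M) ≈⟨ +-congˡ (F-swapped lin p≢q (alt adj) M) ⟩
      F M - F M                         ≈⟨ -‿inverseʳ _ ⟩
      0#                                ∎
      where
      adj = there (adjacent-inject₁ i)
      p≢q = adjacent⇒≢ adj

  -- Cofactors of an alternating multilinear function.

  pad : ∀ {n} → Fin (suc n) → Vector Carrier n → Vector Carrier (suc n)
  pad j u = insertAt u j 0#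

  pad-cong : ∀ {n} j {u v : Vector Carrier n} → u ≋ v → pad j u ≋ pad j v
  pad-cong         zero    eq zero    = refl
  pad-cong         zero    eq (suc k) = eq k
  pad-cong {suc n} (suc j) eq zero    = eq zero
  pad-cong {suc n} (suc j) eq (suc k) = pad-cong j (eq ∘ suc) k

  pad-linear : ∀ {n} j a {u v w : Vector Carrier n} → (w ≋ λ k → a * u k + v k) →
               pad j w ≋ λ k → a * pad j u k + pad j v k
  pad-linear         zero    a eq zero    = solve 1 (λ x → con 0 := x :* con 0 :+ con 0) refl a
  pad-linear         zero    a eq (suc k) = eq k
  pad-linear {suc n} (suc j) a eq zero    = eq zero
  pad-linear {suc n} (suc j) a eq (suc k) = pad-linear j a (eq ∘ suc) k

  pad-zero : ∀ {n} (j : Fin (suc n)) → pad j (const 0#) ≋ const 0#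
  pad-zero         zero    zero    = refl
  pad-zero         zero    (suc k) = refl
  pad-zero {suc n} (suc j) zero    = refl
  pad-zero {suc n} (suc j) (suc k) = pad-zero j k

  pad-unit : ∀ {n} j (i : Fin n) → pad j (unit i) ≋ unit (punchIn j i)
  pad-unit         zero    i       zero    = refl
  pad-unit         zero    i       (suc k) = refl
  pad-unit         (suc j) zero    zero    = refl
  pad-unit         (suc j) zero    (suc k) = pad-zero j k
  pad-unit         (suc j) (suc i) zero    = refl
  pad-unit         (suc j) (suc i) (suc k) = pad-unit j i k

  -- Isolates the multiple of the `j`-th unit vector that `clearMultiples` then removes from every
  -- row below the first.
  pad-removeAt : ∀ {n} (j : Fin (suc n)) (r : Vector Carrier (suc n)) →
                 r ≋ λ k → r j * unit j k + pad j (removeAt r j) k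
  pad-removeAt         zero    r zero    = solve 1 (λ x → x := x :* con 1 :+ con 0) refl (r zero)
  pad-removeAt         zero    r (suc k) = solve 2 (λ x y → y := x :* con 0 :+ y) refl (r zero) (r (suc k))
  pad-removeAt {suc n} (suc j) r zero    = solve 2 (λ x y → y := x :* con 0 :+ y) refl (r (suc j)) (r zero)
  pad-removeAt {suc n} (suc j) r (suc k) = pad-removeAt j (tail r) k

  minor : ∀ {m n} → Matrix (suc m) (suc n) → Fin (suc n) → Matrix m n
  minor M j i = removeAt (M (suc i)) j

  -- Fixing the first row as a unit vector and putting zeros below its 1 turns `F` into a function
  -- of matrices with one row and one column less. For the determinant this is the signed cofactor
  -- of the entry `j` of the first row.
  cofactorForm : ∀ {m n} → (Matrix (suc m) (suc n) → Carrier) → Fin (suc n) → Matrix m n → Carrier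
  cofactorForm F j M = F (unit j ∷ λ i → pad j (M i))

  module _ {m n} {F : Matrix (suc m) (suc n) → Carrier} (lin : Multilinear F) (alt : Alternating F) where
    open Multilinear lin

    cofactorForm-multilinear : ∀ j → Multilinear (cofactorForm F j)
    cofactorForm-multilinear j = record
      { cong   = λ eq → cong λ { zero → ≋-refl ; (suc i) → pad-cong j (eq i) }
      ; linear = λ i a eq off₁ off₂ → linear (suc i) a (pad-linear j a eq)
          (λ { zero _ → ≋-refl ; (suc k) k≢ → pad-cong j (off₁ k (k≢ ∘ ≡.cong suc)) })
          (λ { zero _ → ≋-refl ; (suc k) k≢ → pad-cong j (off₂ k (k≢ ∘ ≡.cong suc)) })
      }

    cofactorForm-alternating : ∀ j → Alternating (cofactorForm F j)
    cofactorForm-alternating j adj eq = alt (there adj) (pad-cong j eq)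

    -- The first row is expanded in unit vectors. With `unit j` on top, every lower row may be
    -- changed by multiples of `unit j`, which clears column `j` and leaves only the minor.
    expand-cofactorForm : ∀ M → F M ≈ ∑[ j < suc n ] (M zero j * cofactorForm F j (minor M j))
    expand-cofactorForm M = begin
      F M
        ≈⟨ cong (λ { zero → ≋-refl ; (suc i) → ≋-refl }) ⟩
      F (M zero ∷ tail M)
        ≈⟨ expandForm (λ r → F (r ∷ tail M))
             (λ eq → cong λ { zero → eq ; (suc i) → ≋-refl })
             (λ a eq → linear zero a eq
                (λ { zero 0≢0 → ⊥-elim (0≢0 ≡.refl) ; (suc k) _ → ≋-refl })
                (λ { zero 0≢0 → ⊥-elim (0≢0 ≡.refl) ; (suc k) _ → ≋-refl }))
             (M zero) ⟩
      ∑[ j < suc n ] (M zero j * F (unit j ∷ tail M))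
        ≈⟨ sum-cong-≋ {suc n} (λ j → *-congˡ {M zero j} (clear j)) ⟩
      ∑[ j < suc n ] (M zero j * cofactorForm F j (minor M j)) ∎
      where
      clear : ∀ j → F (unit j ∷ tail M) ≈ cofactorForm F j (minor M j)
      clear j = clearMultiples (fixFirst lin (unit j)) (unit j)
        (λ i eq → vanish-first lin alt i (≋-sym eq))
        (λ i → M (suc i) j) (λ i → pad-removeAt j (M (suc i)))

  -- Signs of cofactors and uniqueness of the determinant.

  punchIn-inject₁-self : ∀ {n} (j : Fin n) → punchIn (inject₁ j) j ≡ suc j
  punchIn-inject₁-self zero    = ≡.refl
  punchIn-inject₁-self (suc j) = ≡.cong suc (punchIn-inject₁-self j)

  punchIn-suc-self : ∀ {n} (j : Fin n) → punchIn (suc j) j ≡ inject₁ j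
  punchIn-suc-self zero    = ≡.refl
  punchIn-suc-self (suc j) = ≡.cong suc (punchIn-suc-self j)

  punchIn-suc-other : ∀ {n} (j k : Fin n) → k ≢ j → punchIn (suc j) k ≡ punchIn (inject₁ j) k
  punchIn-suc-other zero    zero    k≢j = ⊥-elim (k≢j ≡.refl)
  punchIn-suc-other zero    (suc k) k≢j = ≡.refl
  punchIn-suc-other (suc j) zero    k≢j = ≡.refl
  punchIn-suc-other (suc j) (suc k) k≢j = ≡.cong suc (punchIn-suc-other j k (k≢j ∘ ≡.cong suc))

  module _ {n} {F : Matrix (suc n) (suc n) → Carrier} (lin : Multilinear F) (alt : Alternating F) where
    open Multilinear lin

    private
      moveToTop : Fin (suc n) → Matrix (suc n) (suc n)
      moveToTop j = unit j ∷ λ k → unit (punchIn j k)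

      -- The enumerations that skip `inject₁ j` and `suc j` differ only at position `j`. So one step
      -- of the induction exchanges the top row with a single other row and contributes one factor
      -- -1.
      sign-moveToTop : ∀ j → F (moveToTop j) ≈ (- 1#) ^ toℕ j * F unit
      sign-moveToTop = <-weakInduction _
        (trans (cong λ { zero → ≋-refl ; (suc k) → ≋-refl }) (sym (*-identityˡ _)))
        λ j ih → begin
          F (moveToTop (suc j))
            ≈⟨ swap lin {zero} {suc j} (λ ()) (vanish-first lin alt j) (moveToTop (inject₁ j))
                 (≋-reflexive (≡.cong unit (≡.sym (punchIn-inject₁-self j))))
                 (≋-reflexive (≡.cong unit (punchIn-suc-self j)))
                 (λ { zero 0≢0 _ → ⊥-elim (0≢0 ≡.refl)
                    ; (suc k) _ k≢j → ≋-reflexive (≡.cong unit (punchIn-suc-other j k (k≢j ∘ ≡.cong suc))) }) ⟩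
          - F (moveToTop (inject₁ j))
            ≈⟨ -1*x≈-x _ ⟨
          - 1# * F (moveToTop (inject₁ j))
            ≈⟨ *-congˡ ih ⟩
          - 1# * ((- 1#) ^ toℕ (inject₁ j) * F unit)
            ≈⟨ *-assoc _ _ _ ⟨
          (- 1#) ^ suc (toℕ (inject₁ j)) * F unit
            ≡⟨ ≡.cong (λ k → (- 1#) ^ k * F unit) (toℕ-adjacent (adjacent-inject₁ j)) ⟨
          (- 1#) ^ suc (toℕ j) * F unit ∎

    cofactorForm-unit : ∀ j → cofactorForm F j unit ≈ (- 1#) ^ toℕ j * F unit
    cofactorForm-unit j =
      trans (cong λ { zero → ≋-refl ; (suc k) → pad-unit j k }) (sign-moveToTop j)

  -- Each cofactor form is again multilinear and alternating, so by induction it is the determinant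
  -- of the minor times its value at the identity. That value carries the sign of the cofactor
  -- expansion.
  det-unique : ∀ n {F : Matrix n n → Carrier} → Multilinear F → Alternating F →
               ∀ M → F M ≈ det n M * F unit
  det-unique zero    lin alt M = trans (Multilinear.cong lin λ ()) (sym (*-identityˡ _))
  det-unique (suc n) {F} lin alt M = begin
    F M
      ≈⟨ expand-cofactorForm lin alt M ⟩
    ∑[ j < suc n ] (M zero j * cofactorForm F j (minor M j))
      ≈⟨ sum-cong-≋ {suc n} (λ j → *-congˡ {M zero j} (trans
           (det-unique n (cofactorForm-multilinear lin alt j) (cofactorForm-alternating lin alt j) (minor M j))
           (*-congˡ (cofactorForm-unit lin alt j)))) ⟩
    ∑[ j < suc n ] (M zero j * (det n (minor M j) * ((- 1#) ^ toℕ j * F unit)))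
      ≈⟨ sum-cong-≋ {suc n} (λ j → solve 4 (λ x d s f → x :* (d :* (s :* f)) := s :* x :* d :* f) refl
           (M zero j) (det n (minor M j)) ((- 1#) ^ toℕ j) (F unit)) ⟩
    ∑[ j < suc n ] ((- 1#) ^ toℕ j * M zero j * det n (minor M j) * F unit)
      ≈⟨ *-distribʳ-sum {suc n} (F unit) (λ j → (- 1#) ^ toℕ j * M zero j * det n (minor M j)) ⟨
    det (suc n) M * F unit ∎

  -- The determinant as a function of the columns.

  sum-linear : ∀ {n} a {f g h : Vector Carrier n} → (∀ j → h j ≈ a * f j + g j) → sum h ≈ a * sum f + sum g
  sum-linear {n} a {f} {g} {h} eq = begin
    sum h                        ≈⟨ sum-cong-≋ {n} eq ⟩
    ∑[ j < n ] (a * f j + g j)   ≈⟨ ∑-distrib-+ {n} (λ j → a * f j) g ⟩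
    ∑[ j < n ] (a * f j) + sum g ≈⟨ +-congʳ (*-distribˡ-sum {n} a f) ⟨
    a * sum f + sum g            ∎

  sum-zero : ∀ {n} {f : Vector Carrier n} → (∀ j → f j ≈ 0#) → sum f ≈ 0#
  sum-zero {n} eq = trans (sum-cong-≋ {n} eq) (sum-replicate-zero n)

  sum-cancel : ∀ {n} {p q : Fin n} → Adjacent p q → (f : Vector Carrier n) →
    f p + f q ≈ 0# → (∀ j → j ≢ p → j ≢ q → f j ≈ 0#) → sum f ≈ 0#
  sum-cancel here f cancel others = begin
    f zero + (f (suc zero) + sum (tail (tail f))) ≈⟨ +-assoc _ _ _ ⟨
    f zero + f (suc zero) + sum (tail (tail f))   ≈⟨ +-cong cancel (sum-zero λ j → others (suc (suc j)) (λ ()) λ ()) ⟩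
    0# + 0#                                       ≈⟨ +-identityˡ _ ⟩
    0#                                            ∎
  sum-cancel (there adj) f cancel others = begin
    f zero + sum (tail f) ≈⟨ +-cong (others zero (λ ()) λ ())
                               (sum-cancel adj (tail f) cancel λ j j≢p j≢q →
                                 others (suc j) (j≢p ∘ suc-injective) (j≢q ∘ suc-injective)) ⟩
    0# + 0#               ≈⟨ +-identityˡ _ ⟩
    0#                    ∎

  det-cong : ∀ n {M N : Matrix n n} → (∀ i → M i ≋ N i) → det n M ≈ det n N
  det-cong zero    eq = refl
  det-cong (suc n) eq = sum-cong-≋ {suc n} λ j →
    *-cong (*-congˡ {(- 1#) ^ toℕ j} (eq zero j)) (det-cong n λ i k → eq (suc i) (punchIn j k))

  -- In the first-row expansion the summand at column `q` is linear through its entry, while its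
  -- minor avoids that column. Every other summand is linear through its minor, by induction.
  det-columnLinear : ∀ n q a {M N P : Matrix n n} → (∀ i → P i q ≈ a * M i q + N i q) →
    (∀ i k → k ≢ q → M i k ≈ P i k) → (∀ i k → k ≢ q → N i k ≈ P i k) →
    det n P ≈ a * det n M + det n N
  det-columnLinear (suc n) q a {M} {N} {P} eq offM offN = sum-linear {suc n} a term
    where
    term : ∀ j → (- 1#) ^ toℕ j * P zero j * det n (minor P j)
      ≈ a * ((- 1#) ^ toℕ j * M zero j * det n (minor M j)) + (- 1#) ^ toℕ j * N zero j * det n (minor N j)
    term j with j ≟ q
    ... | yes ≡.refl = begin
      (- 1#) ^ toℕ j * P zero j * det n (minor P j)
        ≈⟨ *-congʳ (*-congˡ (eq zero)) ⟩
      (- 1#) ^ toℕ j * (a * M zero j + N zero j) * det n (minor P j)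
        ≈⟨ solve 5 (λ s a x y d → s :* (a :* x :+ y) :* d := a :* (s :* x :* d) :+ s :* y :* d) refl
             ((- 1#) ^ toℕ j) a (M zero j) (N zero j) _ ⟩
      a * ((- 1#) ^ toℕ j * M zero j * det n (minor P j)) + (- 1#) ^ toℕ j * N zero j * det n (minor P j)
        ≈⟨ +-cong (*-congˡ (*-congˡ (det-cong n λ i k → offM (suc i) _ (punchInᵢ≢i j k))))
                  (*-congˡ (det-cong n λ i k → offN (suc i) _ (punchInᵢ≢i j k))) ⟨
      a * ((- 1#) ^ toℕ j * M zero j * det n (minor M j)) + (- 1#) ^ toℕ j * N zero j * det n (minor N j) ∎
    ... | no j≢q = begin
      (- 1#) ^ toℕ j * P zero j * det n (minor P j)
        ≈⟨ *-congˡ (det-columnLinear n q′ a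
             (λ i → ≡.subst (λ k → P (suc i) k ≈ a * M (suc i) k + N (suc i) k) (≡.sym q′↦q) (eq (suc i)))
             (λ i k k≢q′ → offM (suc i) _ (avoid k k≢q′)) (λ i k k≢q′ → offN (suc i) _ (avoid k k≢q′))) ⟩
      (- 1#) ^ toℕ j * P zero j * (a * det n (minor M j) + det n (minor N j))
        ≈⟨ solve 5 (λ s x a d e → s :* x :* (a :* d :+ e) := a :* (s :* x :* d) :+ s :* x :* e) refl
             ((- 1#) ^ toℕ j) (P zero j) a _ _ ⟩
      a * ((- 1#) ^ toℕ j * P zero j * det n (minor M j)) + (- 1#) ^ toℕ j * P zero j * det n (minor N j)
        ≈⟨ +-cong (*-congˡ (*-congʳ (*-congˡ (offM zero j j≢q)))) (*-congʳ (*-congˡ (offN zero j j≢q))) ⟨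
      a * ((- 1#) ^ toℕ j * M zero j * det n (minor M j)) + (- 1#) ^ toℕ j * N zero j * det n (minor N j) ∎
      where
      q′ = punchOut j≢q
      q′↦q : punchIn j q′ ≡ q
      q′↦q = punchIn-punchOut j≢q
      avoid : ∀ k → k ≢ q′ → punchIn j k ≢ q
      avoid k k≢q′ e = k≢q′ (punchIn-injective j k q′ (≡.trans e (≡.sym q′↦q)))

  -- The summands at `p` and `q` have equal entries and equal minors but opposite signs. All other
  -- minors still contain both equal columns and vanish by induction.
  det-columnAlternating : ∀ n {p q} → Adjacent p q → {M : Matrix n n} → (∀ i → M i p ≈ M i q) → det n M ≈ 0#
  det-columnAlternating (suc n) {p} {q} adj {M} eq = sum-cancel adj _ cancel others
    where
    sameMinor : ∀ i k → minor M p i k ≈ minor M q i k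
    sameMinor i k with punchIn-adjacent adj k
    ... | inj₁ e       = reflexive (≡.cong (M (suc i)) e)
    ... | inj₂ (e , f) = begin
      M (suc i) (punchIn p k) ≡⟨ ≡.cong (M (suc i)) e ⟩
      M (suc i) q             ≈⟨ eq (suc i) ⟨
      M (suc i) p             ≡⟨ ≡.cong (M (suc i)) f ⟨
      M (suc i) (punchIn q k) ∎

    cancel : (- 1#) ^ toℕ p * M zero p * det n (minor M p) + (- 1#) ^ toℕ q * M zero q * det n (minor M q) ≈ 0#
    cancel = begin
      (- 1#) ^ toℕ p * M zero p * det n (minor M p) + (- 1#) ^ toℕ q * M zero q * det n (minor M q)
        ≈⟨ +-congʳ (*-cong (*-congˡ (eq zero)) (det-cong n sameMinor)) ⟩
      (- 1#) ^ toℕ p * M zero q * det n (minor M q) + (- 1#) ^ toℕ q * M zero q * det n (minor M q)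
        ≡⟨ ≡.cong (λ k → (- 1#) ^ toℕ p * M zero q * det n (minor M q) + (- 1#) ^ k * M zero q * det n (minor M q))
             (toℕ-adjacent adj) ⟩
      (- 1#) ^ toℕ p * M zero q * det n (minor M q) + - 1# * (- 1#) ^ toℕ p * M zero q * det n (minor M q)
        ≈⟨ solve 4 (λ u s x d → s :* x :* d :+ u :* s :* x :* d := (u :+ con 1) :* (s :* x :* d)) refl
             (- 1#) ((- 1#) ^ toℕ p) (M zero q) _ ⟩
      (- 1# + 1#) * ((- 1#) ^ toℕ p * M zero q * det n (minor M q))
        ≈⟨ *-congʳ (-‿inverseˡ 1#) ⟩
      0# * ((- 1#) ^ toℕ p * M zero q * det n (minor M q))
        ≈⟨ zeroˡ _ ⟩
      0# ∎

    others : ∀ j → j ≢ p → j ≢ q → (- 1#) ^ toℕ j * M zero j * det n (minor M j) ≈ 0#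
    others j j≢p j≢q with p′ , q′ , adj′ , e , f ← adjacent-punchIn⁻¹ j adj j≢p j≢q =
      trans (*-congˡ {(- 1#) ^ toℕ j * M zero j} (det-columnAlternating n adj′ λ i → begin
        M (suc i) (punchIn j p′) ≡⟨ ≡.cong (M (suc i)) e ⟩
        M (suc i) p              ≈⟨ eq (suc i) ⟩
        M (suc i) q              ≡⟨ ≡.cong (M (suc i)) f ⟨
        M (suc i) (punchIn j q′) ∎))
      (zeroʳ _)

  -- Triangular matrices and transposition.

  det-firstRow : ∀ {n} {M : Matrix (suc n) (suc n)} → (∀ j → M zero (suc j) ≈ 0#) →
                 det (suc n) M ≈ M zero zero * det n (minor M zero)
  det-firstRow {n} {M} eq = begin
    1# * M zero zero * det n (minor M zero)
      + ∑[ j < n ] ((- 1#) ^ toℕ (suc j) * M zero (suc j) * det n (minor M (suc j)))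
      ≈⟨ +-cong (*-congʳ (*-identityˡ _))
           (sum-zero {n} λ j → trans (*-congʳ (*-congˡ {(- 1#) ^ toℕ (suc j)} (eq j)))
             (solve 2 (λ s d → s :* con 0 :* d := con 0) refl ((- 1#) ^ toℕ (suc j)) _)) ⟩
    M zero zero * det n (minor M zero) + 0#
      ≈⟨ +-identityʳ _ ⟩
    M zero zero * det n (minor M zero) ∎

  det-lowerTriangular : ∀ n {M : Matrix n n} → (∀ i j → toℕ i < toℕ j → M i j ≈ 0#) →
                        det n M ≈ product (λ i → M i i)
  det-lowerTriangular zero    upper = refl
  det-lowerTriangular (suc n) {M} upper = trans (det-firstRow {M = M} λ j → upper zero (suc j) (s≤s z≤n))
    (*-congˡ (det-lowerTriangular n {minor M zero} λ i j i<j → upper (suc i) (suc j) (s≤s i<j)))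

  unit-diagonal : ∀ {n} (i : Fin n) → unit i i ≈ 1#
  unit-diagonal zero    = refl
  unit-diagonal (suc i) = unit-diagonal i

  unit-offDiagonal : ∀ {n} (i j : Fin n) → i ≢ j → unit i j ≈ 0#
  unit-offDiagonal zero    zero    i≢j = ⊥-elim (i≢j ≡.refl)
  unit-offDiagonal zero    (suc j) i≢j = refl
  unit-offDiagonal (suc i) zero    i≢j = refl
  unit-offDiagonal (suc i) (suc j) i≢j = unit-offDiagonal i j (i≢j ∘ ≡.cong suc)

  product-one : ∀ {n} {f : Vector Carrier n} → (∀ i → f i ≈ 1#) → product f ≈ 1#
  product-one {zero}  eq = refl
  product-one {suc n} eq = trans (*-cong (eq zero) (product-one (eq ∘ suc))) (*-identityˡ _)

  -- The column properties of `det` are row properties of the map taking `N` to the determinant of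
  -- its transpose, so uniqueness applies to that map. The row properties of `det` itself are
  -- deduced from this afterwards.
  det-transpose : ∀ n (M : Matrix n n) → det n (flip M) ≈ det n M
  det-transpose n M = begin
    det n (flip M)              ≈⟨ det-unique n multilinear det-columnAlternating′ M ⟩
    det n M * det n (flip unit) ≈⟨ *-congˡ (trans (det-lowerTriangular n λ i j i<j →
                                     unit-offDiagonal j i λ { ≡.refl → ℕ.<-irrefl ≡.refl i<j })
                                     (product-one {n} unit-diagonal)) ⟩
    det n M * 1#                ≈⟨ *-identityʳ _ ⟩
    det n M                     ∎
    where
    multilinear : Multilinear (λ N → det n (flip N))
    multilinear = record
      { cong   = λ eq → det-cong n λ i j → eq j i
      ; linear = λ q a eq off₁ off₂ →
          det-columnLinear n q a eq (λ i k k≢q → off₁ k k≢q i) (λ i k k≢q → off₂ k k≢q i)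
      }
    det-columnAlternating′ : Alternating (λ N → det n (flip N))
    det-columnAlternating′ adj eq = det-columnAlternating n adj eq

  det-firstColumn : ∀ {n} {M : Matrix (suc n) (suc n)} → (∀ i → M (suc i) zero ≈ 0#) →
                    det (suc n) M ≈ M zero zero * det n (minor M zero)
  det-firstColumn {n} {M} eq = begin
    det (suc n) M                             ≈⟨ det-transpose (suc n) M ⟨
    det (suc n) (flip M)                      ≈⟨ det-firstRow {M = flip M} eq ⟩
    M zero zero * det n (minor (flip M) zero) ≈⟨ *-congˡ (det-transpose n (minor M zero)) ⟩
    M zero zero * det n (minor M zero)        ∎

  det-linear : ∀ n i a {M N P : Matrix n n} → (P i ≋ λ j → a * M i j + N i j) →
    (∀ k → k ≢ i → M k ≋ P k) → (∀ k → k ≢ i → N k ≋ P k) →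
    det n P ≈ a * det n M + det n N
  det-linear n i a {M} {N} {P} eq off₁ off₂ = begin
    det n P                               ≈⟨ det-transpose n P ⟨
    det n (flip P)                        ≈⟨ det-columnLinear n i a eq (λ j k k≢i → off₁ k k≢i j) (λ j k k≢i → off₂ k k≢i j) ⟩
    a * det n (flip M) + det n (flip N)   ≈⟨ +-cong (*-congˡ (det-transpose n M)) (det-transpose n N) ⟩
    a * det n M + det n N                 ∎

  det-alternating : ∀ n → Alternating (det n)
  det-alternating n adj {M} eq = trans (sym (det-transpose n M)) (det-columnAlternating n adj eq)

  -- Multiplicativity of the determinant.

  infixl 7 _⊗_
  _⊗_ : ∀ {n} → Matrix n n → Matrix n n → Matrix n n
  _⊗_ {n} M N i j = ∑[ k < n ] (M i k * N k j)

  sum-unit : ∀ {n} (i : Fin n) (f : Vector Carrier n) → ∑[ k < n ] (unit i k * f k) ≈ f i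
  sum-unit {suc n} zero f = begin
    1# * f zero + ∑[ k < n ] (0# * f (suc k)) ≈⟨ +-cong (*-identityˡ _) (sum-zero {n} λ k → zeroˡ _) ⟩
    f zero + 0#                               ≈⟨ +-identityʳ _ ⟩
    f zero                                    ∎
  sum-unit {suc n} (suc i) f = begin
    0# * f zero + ∑[ k < n ] (unit i k * f (suc k)) ≈⟨ +-cong (zeroˡ _) (sum-unit i (tail f)) ⟩
    0# + f (suc i)                                  ≈⟨ +-identityˡ _ ⟩
    f (suc i)                                       ∎

  -- For fixed `N` the determinant of the product is multilinear and alternating in the rows of `M`,
  -- and its value at the identity is `det n N`.
  det-⊗ : ∀ n (M N : Matrix n n) → det n (M ⊗ N) ≈ det n M * det n N
  det-⊗ n M N = begin
    det n (M ⊗ N)                ≈⟨ det-unique n multilinear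
                                      (λ adj eq → det-alternating n adj λ j → sum-cong-≋ {n} λ k → *-congʳ (eq k)) M ⟩
    det n M * det n (unit ⊗ N)   ≈⟨ *-congˡ (det-cong n λ i j → sum-unit i (λ k → N k j)) ⟩
    det n M * det n N            ∎
    where
    multilinear : Multilinear (λ M → det n (M ⊗ N))
    multilinear = record
      { cong   = λ eq → det-cong n λ i j → sum-cong-≋ {n} λ k → *-congʳ (eq i k)
      ; linear = λ i a eq off₁ off₂ → det-linear n i a
          (λ j → sum-linear {n} a λ k → trans (*-congʳ (eq k))
             (solve 4 (λ a x y z → (a :* x :+ y) :* z := a :* (x :* z) :+ y :* z) refl _ _ _ _))
          (λ k k≢i j → sum-cong-≋ {n} λ l → *-congʳ (off₁ k k≢i l))
          (λ k k≢i j → sum-cong-≋ {n} λ l → *-congʳ (off₂ k k≢i l))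
      }

-- The commutative ring of integer polynomials.

module IntegerPolynomials where

  open List using ([]; _∷_)

  coeff-+ : ∀ p q k → coeff (p +ₚ q) k ≡ coeff p k ℤ.+ coeff q k
  coeff-+ []      q       k       = ≡.sym (ℤ.+-identityˡ _)
  coeff-+ (a ∷ p) []      k       = ≡.sym (ℤ.+-identityʳ _)
  coeff-+ (a ∷ p) (b ∷ q) zero    = ≡.refl
  coeff-+ (a ∷ p) (b ∷ q) (suc k) = coeff-+ p q k

  coeff-scale : ∀ a q k → coeff (List.map (a ℤ.*_) q) k ≡ a ℤ.* coeff q k
  coeff-scale a []      k       = ≡.sym (ℤ.*-zeroʳ a)
  coeff-scale a (b ∷ q) zero    = ≡.refl
  coeff-scale a (b ∷ q) (suc k) = coeff-scale a q k

  coeff-neg : ∀ p k → coeff (List.map (ℤ.-_) p) k ≡ ℤ.- coeff p k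
  coeff-neg []      k       = ≡.refl
  coeff-neg (a ∷ p) zero    = ≡.refl
  coeff-neg (a ∷ p) (suc k) = coeff-neg p k

  coeff-*-zero : ∀ a p q → coeff ((a ∷ p) *ₚ q) 0 ≡ a ℤ.* coeff q 0
  coeff-*-zero a p q = ≡.trans (coeff-+ (List.map (a ℤ.*_) q) _ 0)
    (≡.trans (ℤ.+-identityʳ _) (coeff-scale a q 0))

  coeff-*-suc : ∀ a p q k → coeff ((a ∷ p) *ₚ q) (suc k) ≡ a ℤ.* coeff q (suc k) ℤ.+ coeff (p *ₚ q) k
  coeff-*-suc a p q k = ≡.trans (coeff-+ (List.map (a ℤ.*_) q) _ (suc k))
    (≡.cong (ℤ._+ coeff (p *ₚ q) k) (coeff-scale a q (suc k)))

  *ₚ-congˡ : ∀ p {q r} → q ≈ₚ r → p *ₚ q ≈ₚ p *ₚ r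
  *ₚ-congˡ []              eq k       = ≡.refl
  *ₚ-congˡ (a ∷ p) {q} {r} eq zero
    rewrite coeff-*-zero a p q | coeff-*-zero a p r | eq 0 = ≡.refl
  *ₚ-congˡ (a ∷ p) {q} {r} eq (suc k)
    rewrite coeff-*-suc a p q k | coeff-*-suc a p r k | eq (suc k) | *ₚ-congˡ p {q} {r} eq k = ≡.refl

  *ₚ-zeroʳ : ∀ p → p *ₚ [] ≈ₚ []
  *ₚ-zeroʳ []      k       = ≡.refl
  *ₚ-zeroʳ (a ∷ p) zero    = ≡.refl
  *ₚ-zeroʳ (a ∷ p) (suc k) = *ₚ-zeroʳ p k

  coeff-*-zeroʳ : ∀ p b q → coeff (p *ₚ (b ∷ q)) 0 ≡ coeff p 0 ℤ.* b
  coeff-*-zeroʳ []      b q = ≡.refl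
  coeff-*-zeroʳ (a ∷ p) b q = coeff-*-zero a p (b ∷ q)

  -- Mirror image of `coeff-*-suc`, peeling the right factor. The two recursions together give
  -- commutativity by induction on the left factor.
  coeff-*-sucʳ : ∀ p b q k → coeff (p *ₚ (b ∷ q)) (suc k) ≡ coeff p (suc k) ℤ.* b ℤ.+ coeff (p *ₚ q) k
  coeff-*-sucʳ []      b q k = ≡.refl
  coeff-*-sucʳ (a ∷ p) b q zero
    rewrite coeff-*-suc a p (b ∷ q) 0 | coeff-*-zeroʳ p b q | coeff-*-zero a p q = ℤ.+-comm (a ℤ.* coeff q 0) _
  coeff-*-sucʳ (a ∷ p) b q (suc k)
    rewrite coeff-*-suc a p (b ∷ q) (suc k) | coeff-*-sucʳ p b q k | coeff-*-suc a p q k =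
    solve 3 (λ x y z → x :+ (y :+ z) := y :+ (x :+ z)) ≡.refl
      (a ℤ.* coeff q (suc k)) (coeff p (suc k) ℤ.* b) (coeff (p *ₚ q) k)
    where open ℤ-Solver.+-*-Solver

  *ₚ-comm : ∀ p q → p *ₚ q ≈ₚ q *ₚ p
  *ₚ-comm []      q k = ≡.sym (*ₚ-zeroʳ q k)
  *ₚ-comm (a ∷ p) q zero
    rewrite coeff-*-zero a p q | coeff-*-zeroʳ q a p = ℤ.*-comm a _
  *ₚ-comm (a ∷ p) q (suc k)
    rewrite coeff-*-suc a p q k | coeff-*-sucʳ q a p k | *ₚ-comm p q k | ℤ.*-comm a (coeff q (suc k)) = ≡.refl

  *ₚ-distribˡ : ∀ p q r → p *ₚ (q +ₚ r) ≈ₚ (p *ₚ q) +ₚ (p *ₚ r)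
  *ₚ-distribˡ []      q r k = ≡.refl
  *ₚ-distribˡ (a ∷ p) q r zero
    rewrite coeff-*-zero a p (q +ₚ r) | coeff-+ q r 0 | coeff-+ ((a ∷ p) *ₚ q) ((a ∷ p) *ₚ r) 0
          | coeff-*-zero a p q | coeff-*-zero a p r = ℤ.*-distribˡ-+ a _ _
  *ₚ-distribˡ (a ∷ p) q r (suc k)
    rewrite coeff-*-suc a p (q +ₚ r) k | coeff-+ q r (suc k) | coeff-+ ((a ∷ p) *ₚ q) ((a ∷ p) *ₚ r) (suc k)
          | coeff-*-suc a p q k | coeff-*-suc a p r k | *ₚ-distribˡ p q r k | coeff-+ (p *ₚ q) (p *ₚ r) k =
    solve 5 (λ a x y z w → a :* (x :+ y) :+ (z :+ w) := a :* x :+ z :+ (a :* y :+ w)) ≡.refl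
      a (coeff q (suc k)) (coeff r (suc k)) (coeff (p *ₚ q) k) (coeff (p *ₚ r) k)
    where open ℤ-Solver.+-*-Solver

  +ₚ-cong : ∀ {p q r s} → p ≈ₚ q → r ≈ₚ s → p +ₚ r ≈ₚ q +ₚ s
  +ₚ-cong {p} {q} {r} {s} e f k rewrite coeff-+ p r k | coeff-+ q s k | e k | f k = ≡.refl

  *ₚ-cong : ∀ {p q r s} → p ≈ₚ q → r ≈ₚ s → p *ₚ r ≈ₚ q *ₚ s
  *ₚ-cong {p} {q} {r} {s} e f k = begin
    coeff (p *ₚ r) k ≡⟨ *ₚ-congˡ p {r} {s} f k ⟩
    coeff (p *ₚ s) k ≡⟨ *ₚ-comm p s k ⟩
    coeff (s *ₚ p) k ≡⟨ *ₚ-congˡ s {p} {q} e k ⟩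
    coeff (s *ₚ q) k ≡⟨ *ₚ-comm s q k ⟩
    coeff (q *ₚ s) k ∎
    where open ≡-Reasoning

  *ₚ-distribʳ : ∀ r p q → (p +ₚ q) *ₚ r ≈ₚ (p *ₚ r) +ₚ (q *ₚ r)
  *ₚ-distribʳ r p q k = ≡.trans (*ₚ-comm (p +ₚ q) r k) (≡.trans (*ₚ-distribˡ r p q k)
    (+ₚ-cong {r *ₚ p} {p *ₚ r} {r *ₚ q} {q *ₚ r} (*ₚ-comm r p) (*ₚ-comm r q) k))

  scale-*ₚ : ∀ a p q → List.map (a ℤ.*_) p *ₚ q ≈ₚ List.map (a ℤ.*_) (p *ₚ q)
  scale-*ₚ a []      q k = ≡.refl
  scale-*ₚ a (b ∷ p) q zero
    rewrite coeff-*-zero (a ℤ.* b) (List.map (a ℤ.*_) p) q | coeff-scale a ((b ∷ p) *ₚ q) 0 | coeff-*-zero b p q =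
    ℤ.*-assoc a b _
  scale-*ₚ a (b ∷ p) q (suc k)
    rewrite coeff-*-suc (a ℤ.* b) (List.map (a ℤ.*_) p) q k | coeff-scale a ((b ∷ p) *ₚ q) (suc k)
          | coeff-*-suc b p q k | scale-*ₚ a p q k | coeff-scale a (p *ₚ q) k =
    solve 4 (λ a b x y → a :* b :* x :+ a :* y := a :* (b :* x :+ y)) ≡.refl
      a b (coeff q (suc k)) (coeff (p *ₚ q) k)
    where open ℤ-Solver.+-*-Solver

  shift-*ₚ : ∀ p q → (ℤ.0ℤ ∷ p) *ₚ q ≈ₚ ℤ.0ℤ ∷ (p *ₚ q)
  shift-*ₚ p q zero    = ≡.trans (coeff-*-zero ℤ.0ℤ p q) (ℤ.*-zeroˡ (coeff q 0))
  shift-*ₚ p q (suc k) = ≡.trans (coeff-*-suc ℤ.0ℤ p q k)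
    (≡.trans (≡.cong (ℤ._+ coeff (p *ₚ q) k) (ℤ.*-zeroˡ (coeff q (suc k)))) (ℤ.+-identityˡ _))

  -- The product with `a ∷ p` is a scaling plus a shift, and both operations can be pulled out of a
  -- product with `r`.
  *ₚ-assoc : ∀ p q r → (p *ₚ q) *ₚ r ≈ₚ p *ₚ (q *ₚ r)
  *ₚ-assoc []      q r k = ≡.refl
  *ₚ-assoc (a ∷ p) q r k = ≡.trans (*ₚ-distribʳ r aq (ℤ.0ℤ ∷ (p *ₚ q)) k)
    (+ₚ-cong {aq *ₚ r} {List.map (a ℤ.*_) (q *ₚ r)} {(ℤ.0ℤ ∷ (p *ₚ q)) *ₚ r} {ℤ.0ℤ ∷ (p *ₚ (q *ₚ r))}
      (scale-*ₚ a q r) shifted k)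
    where
    aq = List.map (a ℤ.*_) q
    shifted : (ℤ.0ℤ ∷ (p *ₚ q)) *ₚ r ≈ₚ ℤ.0ℤ ∷ (p *ₚ (q *ₚ r))
    shifted zero    = shift-*ₚ (p *ₚ q) r 0
    shifted (suc k) = ≡.trans (shift-*ₚ (p *ₚ q) r (suc k)) (*ₚ-assoc p q r k)

  *ₚ-identityˡ : ∀ p → (ℤ.1ℤ ∷ []) *ₚ p ≈ₚ p
  *ₚ-identityˡ p zero    = ≡.trans (coeff-*-zero ℤ.1ℤ [] p) (ℤ.*-identityˡ _)
  *ₚ-identityˡ p (suc k) = ≡.trans (coeff-*-suc ℤ.1ℤ [] p k)
    (≡.trans (ℤ.+-identityʳ _) (ℤ.*-identityˡ _))

  polynomialRing : CommutativeRing 0ℓ 0ℓ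
  polynomialRing = record
    { Carrier = Poly
    ; _≈_     = _≈ₚ_
    ; _+_     = _+ₚ_
    ; _*_     = _*ₚ_
    ; -_      = List.map (ℤ.-_)
    ; 0#      = []
    ; 1#      = ℤ.1ℤ ∷ []
    ; isCommutativeRing = record
      { isRing = record
        { +-isAbelianGroup = record
          { isGroup = record
            { isMonoid = record
              { isSemigroup = record
                { isMagma = record
                  { isEquivalence = record
                    { refl  = λ k → ≡.refl
                    ; sym   = λ e k → ≡.sym (e k)
                    ; trans = λ e f k → ≡.trans (e k) (f k)
                    }
                  ; ∙-cong = λ {p} {q} {r} {s} → +ₚ-cong {p} {q} {r} {s}
                  }
                ; assoc = +ₚ-assoc
                }
              ; identity = (λ p k → ≡.refl) , +ₚ-identityʳ
              }
            ; inverse = +ₚ-inverseˡ , λ p k → ≡.trans (+ₚ-comm p _ k) (+ₚ-inverseˡ p k)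
            ; ⁻¹-cong = λ {p} {q} e k → ≡.trans (coeff-neg p k) (≡.trans (≡.cong ℤ.-_ (e k)) (≡.sym (coeff-neg q k)))
            }
          ; comm = +ₚ-comm
          }
        ; *-cong     = λ {p} {q} {r} {s} → *ₚ-cong {p} {q} {r} {s}
        ; *-assoc    = *ₚ-assoc
        ; *-identity = *ₚ-identityˡ , λ p k → ≡.trans (*ₚ-comm p _ k) (*ₚ-identityˡ p k)
        ; distrib    = *ₚ-distribˡ , *ₚ-distribʳ
        }
      ; *-comm = *ₚ-comm
      }
    }
    where
    +ₚ-assoc : ∀ p q r → (p +ₚ q) +ₚ r ≈ₚ p +ₚ (q +ₚ r)
    +ₚ-assoc p q r k
      rewrite coeff-+ (p +ₚ q) r k | coeff-+ p q k | coeff-+ p (q +ₚ r) k | coeff-+ q r k =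
      ℤ.+-assoc (coeff p k) _ _

    +ₚ-comm : ∀ p q → p +ₚ q ≈ₚ q +ₚ p
    +ₚ-comm p q k rewrite coeff-+ p q k | coeff-+ q p k = ℤ.+-comm (coeff p k) _

    +ₚ-identityʳ : ∀ p → p +ₚ [] ≈ₚ p
    +ₚ-identityʳ p k = ≡.trans (coeff-+ p [] k) (ℤ.+-identityʳ _)

    +ₚ-inverseˡ : ∀ p → List.map (ℤ.-_) p +ₚ p ≈ₚ []
    +ₚ-inverseˡ p k rewrite coeff-+ (List.map (ℤ.-_) p) p k | coeff-neg p k = ℤ.+-inverseˡ (coeff p k)

-- The Hankel determinant for an arbitrary element of a commutative ring.

module NarayanaHankel {c ℓ} (R : CommutativeRing c ℓ) (t : CommutativeRing.Carrier R) where

  open CommutativeRing R hiding (zero)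
  open RingOps rawRing using (det; lucas; narayanaB)
  open Algebra.Definitions.RawSemiring (Semiring.rawSemiring semiring) using (product)
  open Algebra.Properties.Ring ring using (-1*x≈-x; -‿+-comm; -‿involutive)
  open Algebra.Properties.Semiring.Exp semiring using (_^_; ^-homo-*)
  open Algebra.Properties.Semiring.Mult semiring using (_×_; ×-homo-+; ×-comm-*; ×-congˡ)
  open Algebra.Properties.Semiring.Sum semiring
  open Algebra.Properties.Monoid.Sum *-monoid using () renaming (sum-init-last to product-init-last; sum-cong-≋ to product-cong)
  open Algebra.Solver.Ring.NaturalCoefficients.Default commutativeSemiring
  open Determinant R
  open Relation.Binary.Reasoning.Setoid setoid

  -- Summands are functions of natural numbers, so that shifted indices and boundary values beyond
  -- the range make sense.
  sumTo : ℕ → (ℕ → Carrier) → Carrier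
  sumTo N f = ∑[ k < N ] f (toℕ k)

  sumTo-cong : ∀ N {f g} → (∀ k → k < N → f k ≈ g k) → sumTo N f ≈ sumTo N g
  sumTo-cong N eq = sum-cong-≋ {N} λ k → eq (toℕ k) (toℕ<n k)

  sumTo-last : ∀ N f → sumTo (suc N) f ≈ sumTo N f + f N
  sumTo-last N f = trans (sum-init-last {N} (f ∘ toℕ))
    (+-cong (sum-cong-≋ {N} λ k → reflexive (≡.cong f (toℕ-inject₁ k)))
            (reflexive (≡.cong f (toℕ-fromℕ N))))

  sumTo-zero : ∀ N {f} → (∀ k → k < N → f k ≈ 0#) → sumTo N f ≈ 0#
  sumTo-zero N eq = sum-zero {N} λ k → eq (toℕ k) (toℕ<n k)

  sumTo-+ : ∀ N f g → sumTo N (λ k → f k + g k) ≈ sumTo N f + sumTo N g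
  sumTo-+ N f g = ∑-distrib-+ {N} (f ∘ toℕ) (g ∘ toℕ)

  sumTo-*ˡ : ∀ N a f → sumTo N (λ k → a * f k) ≈ a * sumTo N f
  sumTo-*ˡ N a f = sym (*-distribˡ-sum {N} a (f ∘ toℕ))

  -- Laurent coefficients and their recurrence.

  binomialTerm : ℕ → ℕ → ℕ → ℕ → Carrier
  binomialTerm p q k m = ((p C (m ℕ.+ k)) ℕ.* (q C m)) × (t ^ m)

  -- The coefficient of xᵏ in (1 + x)ᵖ (1 + t x⁻¹)^q.
  laurent : ℕ → ℕ → ℕ → Carrier
  laurent p q k = sumTo (suc q) (binomialTerm p q k)

  -- Multiplication by 1 + x, which is Pascal's rule in the first binomial. The degree on the left
  -- is positive because degree 0 would involve the coefficient of 1/x, which `laurent` does not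
  -- record.
  laurent-sucˡ : ∀ p q k → laurent (suc p) q (suc k) ≈ laurent p q k + laurent p q (suc k)
  laurent-sucˡ p q k = 
    trans (sumTo-cong (suc q) λ m _ → term m) (sumTo-+ (suc q) (binomialTerm p q k) (binomialTerm p q (suc k)))
    where
    term : ∀ m → binomialTerm (suc p) q (suc k) m ≈ binomialTerm p q k m + binomialTerm p q (suc k) m
    term m rewrite ℕ.+-suc m k | ≡.sym (nCk+nC[k+1]≡[n+1]C[k+1] p (m ℕ.+ k))
                 | ℕ.*-distribʳ-+ (q C m) (p C (m ℕ.+ k)) (p C suc (m ℕ.+ k)) =
      ×-homo-+ (t ^ m) ((p C (m ℕ.+ k)) ℕ.* (q C m)) ((p C suc (m ℕ.+ k)) ℕ.* (q C m))

  -- Multiplication by 1 + t/x, which is Pascal's rule in the second binomial after shifting the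
  -- summation index.
  laurent-sucʳ : ∀ p q k → laurent p (suc q) k ≈ laurent p q k + t * laurent p q (suc k)
  laurent-sucʳ p q k = begin
    next 0 + sumTo (suc q) (λ m → binomialTerm p (suc q) k (suc m))
      ≈⟨ +-congˡ (trans (sumTo-cong (suc q) λ m _ → term m) (sumTo-+ (suc q) (λ m → t * binomialTerm p q (suc k) m) (next ∘ suc))) ⟩
    next 0 + (sumTo (suc q) (λ m → t * binomialTerm p q (suc k) m) + sumTo (suc q) (next ∘ suc))
      ≈⟨ +-congˡ (+-cong (sumTo-*ˡ (suc q) t (binomialTerm p q (suc k)))
           (trans (sumTo-last q (next ∘ suc)) (trans (+-congˡ last) (+-identityʳ _)))) ⟩
    next 0 + (t * laurent p q (suc k) + sumTo q (next ∘ suc))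
      ≈⟨ solve 3 (λ x y z → x :+ (y :+ z) := x :+ z :+ y) refl _ _ _ ⟩
    laurent p q k + t * laurent p q (suc k) ∎
    where
    next = binomialTerm p q k

    -- The shifted sum runs one index too far; its extra term contains the binomial `q C suc q`.
    last : next (suc q) ≈ 0#
    last rewrite k>n⇒nCk≡0 (ℕ.n<1+n q) | ℕ.*-zeroʳ (p C (suc q ℕ.+ k)) = refl

    term : ∀ m → binomialTerm p (suc q) k (suc m) ≈ t * binomialTerm p q (suc k) m + next (suc m)
    term m rewrite ℕ.+-suc m k | ≡.sym (nCk+nC[k+1]≡[n+1]C[k+1] q m)
                 | ℕ.*-distribˡ-+ (p C suc (m ℕ.+ k)) (q C m) (q C suc m) =
      trans (×-homo-+ (t ^ suc m) (x ℕ.* (q C m)) (x ℕ.* (q C suc m)))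
            (+-congʳ (sym (×-comm-* (x ℕ.* (q C m)) t (t ^ m))))
      where x = p C suc (m ℕ.+ k)

  -- Exchanging x and t/x preserves constant terms. This takes the place of `laurent-sucˡ` in degree
  -- 0.
  laurent-swap : ∀ n → laurent n (suc n) 0 ≈ laurent (suc n) n 0
  laurent-swap n = begin
    sumTo (suc (suc n)) (binomialTerm n (suc n) 0)
      ≈⟨ sumTo-last (suc n) (binomialTerm n (suc n) 0) ⟩
    sumTo (suc n) (binomialTerm n (suc n) 0) + binomialTerm n (suc n) 0 (suc n)
      ≈⟨ +-cong (sumTo-cong (suc n) λ m _ → term m) last ⟩
    laurent (suc n) n 0 + 0#
      ≈⟨ +-identityʳ _ ⟩
    laurent (suc n) n 0 ∎
    where
    last : binomialTerm n (suc n) 0 (suc n) ≈ 0#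
    last rewrite ℕ.+-identityʳ n | k>n⇒nCk≡0 (ℕ.n<1+n n) = refl

    term : ∀ m → binomialTerm n (suc n) 0 m ≈ binomialTerm (suc n) n 0 m
    term m rewrite ℕ.+-identityʳ m = ×-congˡ (ℕ.*-comm (n C m) (suc n C m))

  -- The tridiagonal operator with diagonal entry `β` and first superdiagonal entry `w` left free:
  -- `β = 1# + t` with `w = t + t` gives J, raising `β` by one gives 1 + J, and `w = t` arises when
  -- the first row and column are dropped.
  jacobi : Carrier → Carrier → (ℕ → Carrier) → ℕ → Carrier
  jacobi β w b zero    = β * b 0 + w * b 1
  jacobi β w b (suc k) = b k + β * b (suc k) + t * b (suc (suc k))

  coefficient : ℕ → ℕ → Carrier
  coefficient n = laurent n n

  -- One factor 1 + t/x and one factor 1 + x are split off. In degree 0 the coefficient of 1/x folds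
  -- back onto that of x with a factor t, which doubles the superdiagonal entry there.
  coefficient-suc : ∀ n k → coefficient (suc n) k ≈ jacobi (1# + t) (t + t) (coefficient n) k
  coefficient-suc n zero = begin
    coefficient (suc n) 0
      ≈⟨ laurent-sucʳ (suc n) n 0 ⟩
    laurent (suc n) n 0 + t * laurent (suc n) n 1
      ≈⟨ +-cong (trans (sym (laurent-swap n)) (laurent-sucʳ n n 0)) (*-congˡ (laurent-sucˡ n n 0)) ⟩
    coefficient n 0 + t * coefficient n 1 + t * (coefficient n 0 + coefficient n 1)
      ≈⟨ solve 3 (λ t x y → x :+ t :* y :+ t :* (x :+ y) := (con 1 :+ t) :* x :+ (t :+ t) :* y) refl t _ _ ⟩
    jacobi (1# + t) (t + t) (coefficient n) 0 ∎
  coefficient-suc n (suc k) = begin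
    coefficient (suc n) (suc k)
      ≈⟨ laurent-sucʳ (suc n) n (suc k) ⟩
    laurent (suc n) n (suc k) + t * laurent (suc n) n (suc (suc k))
      ≈⟨ +-cong (laurent-sucˡ n n k) (*-congˡ (laurent-sucˡ n n (suc k))) ⟩
    coefficient n k + coefficient n (suc k) + t * (coefficient n (suc k) + coefficient n (suc (suc k)))
      ≈⟨ solve 4 (λ t x y z → x :+ y :+ t :* (y :+ z) := x :+ (con 1 :+ t) :* y :+ t :* z) refl t _ _ _ ⟩
    jacobi (1# + t) (t + t) (coefficient n) (suc k) ∎

  coefficient-upper : ∀ {n k} → n < k → coefficient n k ≈ 0#
  coefficient-upper {n} {k} n<k = sumTo-zero (suc n) λ m _ → term m
    where
    term : ∀ m → binomialTerm n n k m ≈ 0#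
    term m rewrite k>n⇒nCk≡0 (ℕ.<-≤-trans n<k (ℕ.m≤n+m k m)) = refl

  coefficient-diagonal : ∀ n → coefficient n n ≈ 1#
  coefficient-diagonal n = begin
    binomialTerm n n n 0 + sumTo n (λ m → binomialTerm n n n (suc m))
      ≈⟨ +-cong first (sumTo-zero n λ m _ → term m) ⟩
    1# + 0#
      ≈⟨ +-identityʳ 1# ⟩
    1# ∎
    where
    first : binomialTerm n n n 0 ≈ 1#
    first rewrite nCn≡1 n = +-identityʳ 1#

    term : ∀ m → binomialTerm n n n (suc m) ≈ 0#
    term m rewrite k>n⇒nCk≡0 {n} {suc m ℕ.+ n} (s≤s (ℕ.m≤n+m n m)) = refl

  narayanaB-coefficient : ∀ n → narayanaB n t ≈ coefficient n 0
  narayanaB-coefficient n = sumTo-cong (suc n) λ m _ → term m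
    where
    term : ∀ m → ((n C m) ℕ.^ 2) × (t ^ m) ≈ binomialTerm n n 0 m
    term m rewrite ℕ.+-identityʳ m | ℕ.*-identityʳ (n C m) = refl

  -- Self-adjointness and the Gram form of the Hankel entries.

  weight : ℕ → Carrier
  weight zero          = 1#
  weight (suc zero)    = t + t
  weight (suc (suc k)) = t * weight (suc k)

  -- Lagrange's identity: the operator is self-adjoint up to a boundary term.
  jacobi-selfAdjoint : ∀ β (a b : ℕ → Carrier) N →
    sumTo (suc N) (λ k → jacobi β (t + t) a k * weight k * b k) + weight (suc N) * a N * b (suc N) ≈
    sumTo (suc N) (λ k → a k * weight k * jacobi β (t + t) b k) + weight (suc N) * a (suc N) * b N
  jacobi-selfAdjoint β a b zero =
    solve 6 (λ β t a₀ a₁ b₀ b₁ →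
      (β :* a₀ :+ (t :+ t) :* a₁) :* con 1 :* b₀ :+ con 0 :+ (t :+ t) :* a₀ :* b₁ :=
      a₀ :* con 1 :* (β :* b₀ :+ (t :+ t) :* b₁) :+ con 0 :+ (t :+ t) :* a₁ :* b₀)
      refl β t (a 0) (a 1) (b 0) (b 1)
  jacobi-selfAdjoint β a b (suc N) = begin
    sumTo (2 ℕ.+ N) f + t * D * a₁ * b₂
      ≈⟨ +-congʳ (sumTo-last (suc N) f) ⟩
    sumTo (suc N) f + (a₀ + β * a₁ + t * a₂) * D * b₁ + t * D * a₁ * b₂
      ≈⟨ solve 9 (λ S β t D a₀ a₁ a₂ b₁ b₂ →
           S :+ (a₀ :+ β :* a₁ :+ t :* a₂) :* D :* b₁ :+ t :* D :* a₁ :* b₂ :=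
           (S :+ D :* a₀ :* b₁) :+ ((β :* a₁ :+ t :* a₂) :* D :* b₁ :+ t :* D :* a₁ :* b₂))
           refl _ β t D a₀ a₁ a₂ b₁ b₂ ⟩
    (sumTo (suc N) f + D * a₀ * b₁) + ((β * a₁ + t * a₂) * D * b₁ + t * D * a₁ * b₂)
      ≈⟨ +-congʳ (jacobi-selfAdjoint β a b N) ⟩
    (sumTo (suc N) g + D * a₁ * b₀) + ((β * a₁ + t * a₂) * D * b₁ + t * D * a₁ * b₂)
      ≈⟨ solve 9 (λ S β t D b₀ a₁ a₂ b₁ b₂ →
           (S :+ D :* a₁ :* b₀) :+ ((β :* a₁ :+ t :* a₂) :* D :* b₁ :+ t :* D :* a₁ :* b₂) :=
           S :+ a₁ :* D :* (b₀ :+ β :* b₁ :+ t :* b₂) :+ t :* D :* a₂ :* b₁)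
           refl _ β t D b₀ a₁ a₂ b₁ b₂ ⟩
    sumTo (suc N) g + a₁ * D * (b₀ + β * b₁ + t * b₂) + t * D * a₂ * b₁
      ≈⟨ +-congʳ (sumTo-last (suc N) g) ⟨
    sumTo (2 ℕ.+ N) g + t * D * a₂ * b₁ ∎
    where
    f = λ k → jacobi β (t + t) a k * weight k * b k
    g = λ k → a k * weight k * jacobi β (t + t) b k
    D = weight (suc N)
    a₀ = a N
    a₁ = a (suc N)
    a₂ = a (suc (suc N))
    b₀ = b N
    b₁ = b (suc N)
    b₂ = b (suc (suc N))

  pairing : ℕ → ℕ → ℕ → Carrier
  pairing N i j = sumTo N λ k → coefficient i k * weight k * coefficient j k

  -- The boundary terms of the self-adjointness identity contain `coefficient i` at the last index
  -- of the sum and at the next one. Both exceed `i`, so both terms vanish.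
  pairing-shift : ∀ {N} i j → suc i < N → pairing N (suc i) j ≈ pairing N i (suc j)
  pairing-shift {suc N} i j (s≤s i<N) = begin
    pairing (suc N) (suc i) j
      ≈⟨ sumTo-cong (suc N) (λ k _ → *-congʳ {b k} (*-congʳ {weight k} (coefficient-suc i k))) ⟩
    sumTo (suc N) (λ k → jacobi (1# + t) (t + t) a k * weight k * b k)
      ≈⟨ +-identityʳ _ ⟨
    sumTo (suc N) (λ k → jacobi (1# + t) (t + t) a k * weight k * b k) + 0#
      ≈⟨ +-congˡ (vanish (coefficient-upper i<N)) ⟨
    sumTo (suc N) (λ k → jacobi (1# + t) (t + t) a k * weight k * b k) + weight (suc N) * a N * b (suc N)
      ≈⟨ jacobi-selfAdjoint (1# + t) a b N ⟩
    sumTo (suc N) (λ k → a k * weight k * jacobi (1# + t) (t + t) b k) + weight (suc N) * a (suc N) * b N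
      ≈⟨ +-congˡ (vanish (coefficient-upper (ℕ.m<n⇒m<1+n i<N))) ⟩
    sumTo (suc N) (λ k → a k * weight k * jacobi (1# + t) (t + t) b k) + 0#
      ≈⟨ +-identityʳ _ ⟩
    sumTo (suc N) (λ k → a k * weight k * jacobi (1# + t) (t + t) b k)
      ≈⟨ sumTo-cong (suc N) (λ k _ → *-congˡ {a k * weight k} (coefficient-suc j k)) ⟨
    pairing (suc N) i (suc j) ∎
    where
    a = coefficient i
    b = coefficient j
    vanish : ∀ {x y z} → x ≈ 0# → y * x * z ≈ 0#
    vanish x≈0 = trans (*-congʳ (*-congˡ x≈0)) (solve 2 (λ y z → y :* con 0 :* z := con 0) refl _ _)

  -- Shifting moves all of `i` to the second argument. Row 0 of the coefficients is 1, 0, 0, ..., so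
  -- only the summand with `k = 0` remains.
  pairing-coefficient : ∀ {N} i j → i < N → pairing N i j ≈ coefficient (i ℕ.+ j) 0
  pairing-coefficient {suc N} zero j _ = begin
    coefficient 0 0 * 1# * coefficient j 0 + sumTo N (λ k → coefficient 0 (suc k) * weight (suc k) * coefficient j (suc k))
      ≈⟨ +-cong (*-congʳ (*-congʳ (coefficient-diagonal 0)))
           (sumTo-zero N λ k _ → trans
             (*-congʳ {coefficient j (suc k)} (*-congʳ {weight (suc k)} (coefficient-upper {0} {suc k} (s≤s z≤n))))
             (solve 2 (λ x y → con 0 :* x :* y := con 0) refl (weight (suc k)) (coefficient j (suc k)))) ⟩
    1# * 1# * coefficient j 0 + 0#
      ≈⟨ solve 1 (λ x → con 1 :* con 1 :* x :+ con 0 := x) refl _ ⟩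
    coefficient j 0 ∎
  pairing-coefficient {N} (suc i) j i<N = begin
    pairing N (suc i) j           ≈⟨ pairing-shift i j i<N ⟩
    pairing N i (suc j)           ≈⟨ pairing-coefficient i (suc j) (ℕ.<-trans (ℕ.n<1+n i) i<N) ⟩
    coefficient (i ℕ.+ suc j) 0   ≡⟨ ≡.cong (λ n → coefficient n 0) (ℕ.+-suc i j) ⟩
    coefficient (suc i ℕ.+ j) 0   ∎

  -- Truncations of 1 + J and their determinants.

  diagonal : Carrier
  diagonal = 1# + (1# + t)

  -- The last clause drops the first row and column and resets `w` to `t`, so the minors in the
  -- expansion reduce to matrices of the same family by computation.
  tridiagonal : Carrier → ℕ → ℕ → Carrier
  tridiagonal w zero    zero          = diagonal
  tridiagonal w zero    (suc zero)    = w
  tridiagonal w zero    (suc (suc l)) = 0#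
  tridiagonal w (suc k) zero          = firstColumn k
    where
    firstColumn : ℕ → Carrier
    firstColumn zero    = 1#
    firstColumn (suc k) = 0#
  tridiagonal w (suc k) (suc l)       = tridiagonal t k l

  -- Truncation to size `N` affects only the last row, which loses its term with `b N`; that value
  -- is zero by hypothesis.
  tridiagonal-jacobi : ∀ w k N b → k < N → b N ≈ 0# →
    sumTo N (λ l → tridiagonal w k l * b l) ≈ jacobi diagonal w b k
  tridiagonal-jacobi w zero (suc zero) b _ bN≈0 = +-congˡ (sym (trans (*-congˡ bN≈0) (zeroʳ w)))
  tridiagonal-jacobi w zero (suc (suc N)) b _ _ =
    +-congˡ (trans (+-congˡ (sumTo-zero N λ l _ → zeroˡ (b (suc (suc l))))) (+-identityʳ _))
  tridiagonal-jacobi w (suc zero) (suc N) b (s≤s k<N) bN≈0 = begin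
    1# * b 0 + sumTo N (λ l → tridiagonal t 0 l * b (suc l))
      ≈⟨ +-cong (*-identityˡ _) (tridiagonal-jacobi t 0 N (b ∘ suc) k<N bN≈0) ⟩
    b 0 + (diagonal * b 1 + t * b 2)
      ≈⟨ +-assoc _ _ _ ⟨
    b 0 + diagonal * b 1 + t * b 2 ∎
  tridiagonal-jacobi w (suc (suc k)) (suc N) b (s≤s k<N) bN≈0 = begin
    0# * b 0 + sumTo N (λ l → tridiagonal t (suc k) l * b (suc l))
      ≈⟨ +-cong (zeroˡ _) (tridiagonal-jacobi t (suc k) N (b ∘ suc) k<N bN≈0) ⟩
    0# + jacobi diagonal w b (suc (suc k))
      ≈⟨ +-identityˡ _ ⟩
    jacobi diagonal w b (suc (suc k)) ∎

  tridiagonalMatrix : Carrier → ∀ n → Matrix n n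
  tridiagonalMatrix w n i j = tridiagonal w (toℕ i) (toℕ j)

  -- The continuant recurrence: the first row has two possibly nonzero entries, and in the minor of
  -- the second one the first column is 1 followed by zeros.
  det-tridiagonal : ∀ w n → det (2 ℕ.+ n) (tridiagonalMatrix w (2 ℕ.+ n)) ≈
    diagonal * det (suc n) (tridiagonalMatrix t (suc n)) + - w * det n (tridiagonalMatrix t n)
  det-tridiagonal w n = begin
    1# * diagonal * K + (- 1# * 1# * w * det (suc n) (minor T (suc zero))
      + ∑[ j < n ] ((- 1#) ^ toℕ (suc (suc j)) * 0# * det (suc n) (minor T (suc (suc j)))))
      ≈⟨ +-cong (*-congʳ (*-identityˡ diagonal))
           (+-cong (*-cong (trans (*-congʳ (*-identityʳ _)) (-1*x≈-x w)) second)
             (sum-zero {n} λ j → solve 2 (λ s d → s :* con 0 :* d := con 0) refl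
               ((- 1#) ^ toℕ (suc (suc j))) (det (suc n) (minor T (suc (suc j)))))) ⟩
    diagonal * K + (- w * det n (tridiagonalMatrix t n) + 0#)
      ≈⟨ +-congˡ (+-identityʳ _) ⟩
    diagonal * K + - w * det n (tridiagonalMatrix t n) ∎
    where
    T = tridiagonalMatrix w (2 ℕ.+ n)
    K = det (suc n) (tridiagonalMatrix t (suc n))
    second : det (suc n) (minor T (suc zero)) ≈ det n (tridiagonalMatrix t n)
    second = trans (det-firstColumn {n} {minor T (suc zero)} λ i → refl) (*-identityˡ _)

  -- Lucas polynomials as tridiagonal determinants.

  two : Carrier
  two = 2 × 1#

  negate-argument : - 1# * (- t + - two) ≈ diagonal
  negate-argument = begin
    - 1# * (- t + - two) ≈⟨ -1*x≈-x _ ⟩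
    - (- t + - two)      ≈⟨ -‿cong (-‿+-comm t two) ⟩
    - - (t + two)        ≈⟨ -‿involutive _ ⟩
    t + two              ≈⟨ solve 1 (λ t → t :+ (con 1 :+ (con 1 :+ con 0)) := con 1 :+ (con 1 :+ t)) refl t ⟩
    diagonal             ∎

  -- The Lucas polynomials satisfy the recurrence of the determinants of tridiagonalMatrix t,
  -- whose first superdiagonal entry is doubled because L₀ = 2 instead of 1.
  lucas-det : ∀ n → (- 1#) ^ suc n * lucas (suc n) (- t + - two) (- t) ≈
                    det (suc n) (tridiagonalMatrix (t + t) (suc n))
  lucas-det zero = begin
    - 1# * 1# * (- t + - two) ≈⟨ *-congʳ (*-identityʳ _) ⟩
    - 1# * (- t + - two)      ≈⟨ negate-argument ⟩
    diagonal                  ≈⟨ solve 1 (λ d → d := con 1 :* d :* con 1 :+ con 0) refl diagonal ⟩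
    1# * diagonal * 1# + 0#   ∎
  lucas-det (suc n) = begin
    signed (2 ℕ.+ n)                        ≈⟨ signed-K n ⟩
    diagonal * K (suc n) + (s + s) * K n    ≈⟨ +-congˡ (*-congʳ (-‿+-comm t t)) ⟩
    diagonal * K (suc n) + - (t + t) * K n  ≈⟨ det-tridiagonal (t + t) n ⟨
    det (2 ℕ.+ n) (tridiagonalMatrix (t + t) (2 ℕ.+ n)) ∎
    where
    s = - t
    x = - t + - two
    K = λ n → det n (tridiagonalMatrix t n)
    signed = λ n → (- 1#) ^ n * lucas n x s

    signed-rec : ∀ n → signed (2 ℕ.+ n) ≈ diagonal * signed (suc n) + s * signed n
    signed-rec n = begin
      - 1# * (- 1# * e) * (x * L₁ + s * L₀)
        ≈⟨ solve 6 (λ u e x s y z → u :* (u :* e) :* (x :* y :+ s :* z) :=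
             (u :* x) :* (u :* e :* y) :+ (u :* u) :* (s :* (e :* z))) refl (- 1#) e x s L₁ L₀ ⟩
      (- 1# * x) * signed (suc n) + (- 1# * - 1#) * (s * signed n)
        ≈⟨ +-cong (*-congʳ negate-argument) (trans (*-congʳ (trans (-1*x≈-x (- 1#)) (-‿involutive 1#))) (*-identityˡ _)) ⟩
      diagonal * signed (suc n) + s * signed n ∎
      where
      e = (- 1#) ^ n
      L₁ = lucas (suc n) x s
      L₀ = lucas n x s

    K-one : K 1 ≈ diagonal
    K-one = solve 1 (λ d → con 1 :* d :* con 1 :+ con 0 := d) refl diagonal

    signed-one : signed 1 ≈ diagonal
    signed-one = trans (*-congʳ (*-identityʳ _)) negate-argument

    signed-two : signed 2 ≈ diagonal * diagonal + (s + s)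
    signed-two = trans (signed-rec 0) (trans (+-congʳ (*-congˡ signed-one))
      (solve 2 (λ d s → d :* d :+ s :* (con 1 :* (con 1 :+ (con 1 :+ con 0))) := d :* d :+ (s :+ s)) refl diagonal s))

    -- Both sides satisfy the same second-order recurrence, with coefficients `diagonal` and `s`, so
    -- agreement at two consecutive indices suffices.
    signed-K : ∀ n → signed (2 ℕ.+ n) ≈ diagonal * K (suc n) + (s + s) * K n
    signed-K zero = begin
      signed 2                                ≈⟨ signed-two ⟩
      diagonal * diagonal + (s + s)           ≈⟨ +-cong (*-congˡ K-one) (*-identityʳ _) ⟨
      diagonal * K 1 + (s + s) * 1#           ∎
    signed-K (suc zero) = begin
      signed 3
        ≈⟨ signed-rec 1 ⟩
      diagonal * signed 2 + s * signed 1
        ≈⟨ +-cong (*-congˡ signed-two) (*-congˡ signed-one) ⟩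
      diagonal * (diagonal * diagonal + (s + s)) + s * diagonal
        ≈⟨ solve 2 (λ d s → d :* (d :* d :+ (s :+ s)) :+ s :* d :=
             d :* (d :* d :+ s :* con 1) :+ (s :+ s) :* d) refl diagonal s ⟩
      diagonal * (diagonal * diagonal + s * 1#) + (s + s) * diagonal
        ≈⟨ +-cong (*-congˡ (trans (det-tridiagonal t 0) (+-congʳ (*-congˡ K-one)))) (*-congˡ K-one) ⟨
      diagonal * K 2 + (s + s) * K 1 ∎
    signed-K (suc (suc n)) = begin
      signed (4 ℕ.+ n)
        ≈⟨ signed-rec (2 ℕ.+ n) ⟩
      diagonal * signed (3 ℕ.+ n) + s * signed (2 ℕ.+ n)
        ≈⟨ +-cong (*-congˡ (signed-K (suc n))) (*-congˡ (signed-K n)) ⟩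
      diagonal * (diagonal * K (2 ℕ.+ n) + (s + s) * K (suc n)) + s * (diagonal * K (suc n) + (s + s) * K n)
        ≈⟨ solve 5 (λ d s x y z → d :* (d :* x :+ (s :+ s) :* y) :+ s :* (d :* y :+ (s :+ s) :* z) :=
             d :* (d :* x :+ s :* y) :+ (s :+ s) :* (d :* y :+ s :* z))
             refl diagonal s (K (2 ℕ.+ n)) (K (suc n)) (K n) ⟩
      diagonal * (diagonal * K (2 ℕ.+ n) + s * K (suc n)) + (s + s) * (diagonal * K (suc n) + s * K n)
        ≈⟨ +-cong (*-congˡ (det-tridiagonal t (suc n))) (*-congˡ (det-tridiagonal t n)) ⟨
      diagonal * K (3 ℕ.+ n) + (s + s) * K (2 ℕ.+ n) ∎

  -- The product of the weights and the factorization of the Hankel matrix.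

  weight-suc : ∀ k → weight (suc k) ≈ two * t ^ suc k
  weight-suc zero    = solve 1 (λ t → t :+ t := (con 1 :+ (con 1 :+ con 0)) :* (t :* con 1)) refl t
  weight-suc (suc k) = trans (*-congˡ (weight-suc k))
    (solve 3 (λ a b c → a :* (b :* c) := b :* (a :* c)) refl t two (t ^ suc k))

  product-weight : ∀ n → product {suc n} (λ k → weight (toℕ k)) ≈ t ^ (suc n C 2) * two ^ n
  product-weight zero    = refl
  product-weight (suc n) = begin
    product {2 ℕ.+ n} (λ k → weight (toℕ k))
      ≈⟨ product-init-last {suc n} (λ k → weight (toℕ k)) ⟩
    product {suc n} (λ k → weight (toℕ (inject₁ k))) * weight (toℕ (fromℕ (suc n)))
      ≈⟨ *-cong (product-cong {suc n} λ k → reflexive (≡.cong weight (toℕ-inject₁ k)))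
                (reflexive (≡.cong weight (toℕ-fromℕ (suc n)))) ⟩
    product {suc n} (λ k → weight (toℕ k)) * weight (suc n)
      ≈⟨ *-cong (product-weight n) (weight-suc n) ⟩
    t ^ (suc n C 2) * two ^ n * (two * t ^ suc n)
      ≈⟨ solve 4 (λ x y z w → x :* y :* (z :* w) := (w :* x) :* (z :* y)) refl
           (t ^ (suc n C 2)) (two ^ n) two (t ^ suc n) ⟩
    (t ^ suc n * t ^ (suc n C 2)) * two ^ suc n
      ≈⟨ *-congʳ (^-homo-* t (suc n) (suc n C 2)) ⟨
    t ^ (suc n ℕ.+ (suc n C 2)) * two ^ suc n
      -- Reading `suc n` as `suc n C 1` turns the sum of the exponents into an instance of Pascal's
      -- rule.
      ≡⟨ ≡.cong (λ e → t ^ e * two ^ suc n)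
           (≡.trans (≡.cong (ℕ._+ (suc n C 2)) (≡.sym (nC1≡n (suc n)))) (nCk+nC[k+1]≡[n+1]C[k+1] (suc n) 1)) ⟩
    t ^ ((2 ℕ.+ n) C 2) * two ^ suc n ∎

  narayanaHankel : ∀ n → Matrix n n
  narayanaHankel n i j = narayanaB (toℕ i ℕ.+ toℕ j) t + narayanaB (toℕ i ℕ.+ toℕ j ℕ.+ 1) t

  coefficients : ∀ n → Matrix n n
  coefficients n i k = coefficient (toℕ i) (toℕ k)

  weightedCoefficients : ∀ n → Matrix n n
  weightedCoefficients n i k = coefficient (toℕ i) (toℕ k) * weight (toℕ k)

  -- Both Hankel entries pair row `i` with row `j` or its successor, and the successor is J applied
  -- to row `j`. Cutting all sums at `n` loses nothing, since rows `i` and `j` vanish from index `n`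
  -- on.
  narayanaHankel-factorization : ∀ n i j → narayanaHankel n i j ≈
    (weightedCoefficients n ⊗ (tridiagonalMatrix (t + t) n ⊗ flip (coefficients n))) i j
  narayanaHankel-factorization n i′ j′ = begin
    narayanaB (i ℕ.+ j) t + narayanaB (i ℕ.+ j ℕ.+ 1) t
      ≡⟨ ≡.cong (λ m → narayanaB (i ℕ.+ j) t + narayanaB m t)
           (≡.trans (ℕ.+-assoc i j 1) (≡.cong (i ℕ.+_) (ℕ.+-comm j 1))) ⟩
    narayanaB (i ℕ.+ j) t + narayanaB (i ℕ.+ suc j) t
      ≈⟨ +-cong (narayanaB-coefficient (i ℕ.+ j)) (narayanaB-coefficient (i ℕ.+ suc j)) ⟩
    coefficient (i ℕ.+ j) 0 + coefficient (i ℕ.+ suc j) 0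
      ≈⟨ +-cong (pairing-coefficient i j (toℕ<n i′)) (pairing-coefficient i (suc j) (toℕ<n i′)) ⟨
    pairing n i j + pairing n i (suc j)
      ≈⟨ sumTo-+ n (λ k → coefficient i k * weight k * coefficient j k)
                   (λ k → coefficient i k * weight k * coefficient (suc j) k) ⟨
    sumTo n (λ k → coefficient i k * weight k * coefficient j k + coefficient i k * weight k * coefficient (suc j) k)
      ≈⟨ sumTo-cong n (λ k k<n → trans (sym (distribˡ (coefficient i k * weight k) (coefficient j k) (coefficient (suc j) k)))
           (*-congˡ {coefficient i k * weight k} (trans (+-congˡ (coefficient-suc j k)) (trans (shift k)
             (sym (tridiagonal-jacobi (t + t) k n (coefficient j) k<n (coefficient-upper (toℕ<n j′)))))))) ⟩
    (weightedCoefficients n ⊗ (tridiagonalMatrix (t + t) n ⊗ flip (coefficients n))) i′ j′ ∎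
    where
    i = toℕ i′
    j = toℕ j′
    shift : ∀ {b} k → b k + jacobi (1# + t) (t + t) b k ≈ jacobi diagonal (t + t) b k
    shift zero    = solve 4 (λ x β w y → x :+ (β :* x :+ w :* y) := (con 1 :+ β) :* x :+ w :* y) refl _ _ _ _
    shift (suc k) = solve 5 (λ x β t y z → x :+ (z :+ β :* x :+ t :* y) := z :+ (con 1 :+ β) :* x :+ t :* y) refl _ _ _ _ _

  det-narayanaHankel : ∀ n → det (suc n) (narayanaHankel (suc n)) ≈
    (- 1#) ^ suc n * t ^ (suc n C 2) * two ^ n * lucas (suc n) (- t + - two) (- t)
  det-narayanaHankel m = begin
    det n (narayanaHankel n)
      ≈⟨ det-cong n (narayanaHankel-factorization n) ⟩
    det n (weightedCoefficients n ⊗ (T ⊗ flip (coefficients n)))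
      ≈⟨ trans (det-⊗ n (weightedCoefficients n) (T ⊗ flip (coefficients n)))
           (*-congˡ (det-⊗ n T (flip (coefficients n)))) ⟩
    det n (weightedCoefficients n) * (det n T * det n (flip (coefficients n)))
      -- The weights sit in the left factor, which stays lower triangular with the weights on its
      -- diagonal; the right factor is the transpose of a unitriangular matrix.
      ≈⟨ *-cong det-weighted (*-cong (sym (lucas-det m)) det-coefficients) ⟩
    t ^ (n C 2) * two ^ m * ((- 1#) ^ n * L * 1#)
      ≈⟨ solve 4 (λ a b c d → a :* b :* (c :* d :* con 1) := c :* a :* b :* d) refl (t ^ (n C 2)) (two ^ m) ((- 1#) ^ n) L ⟩
    (- 1#) ^ n * t ^ (n C 2) * two ^ m * L ∎
    where
    n = suc m
    T = tridiagonalMatrix (t + t) n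
    L = lucas n (- t + - two) (- t)
    det-weighted : det n (weightedCoefficients n) ≈ t ^ (n C 2) * two ^ m
    det-weighted = begin
      det n (weightedCoefficients n)
        ≈⟨ det-lowerTriangular n {weightedCoefficients n} (λ i j i<j →
             trans (*-congʳ {weight (toℕ j)} (coefficient-upper i<j)) (zeroˡ _)) ⟩
      product {n} (λ k → coefficient (toℕ k) (toℕ k) * weight (toℕ k))
        ≈⟨ product-cong {n} (λ k → trans (*-congʳ {weight (toℕ k)} (coefficient-diagonal (toℕ k))) (*-identityˡ _)) ⟩
      product {n} (λ k → weight (toℕ k))
        ≈⟨ product-weight m ⟩
      t ^ (n C 2) * two ^ m ∎
    det-coefficients : det n (flip (coefficients n)) ≈ 1#
    det-coefficients = trans (det-transpose n (coefficients n))
      (trans (det-lowerTriangular n {coefficients n} (λ i j i<j → coefficient-upper i<j))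
             (product-one {n} λ k → coefficient-diagonal (toℕ k)))

mainTheorem6 : let open RingOps ℤ[t] in
    (n : ℕ) → 1 ≤ n →
    det n (λ i j → narayanaB (toℕ i ℕ.+ toℕ j) t + narayanaB (toℕ i ℕ.+ toℕ j ℕ.+ 1) t)
    ≈ ((- 1#) ^ n) * (t ^ (n C 2)) * ((2 × 1#) ^ (n ∸ 1)) * lucas n ((- t) - (2 × 1#)) (- t)
-- The operations of `polynomialRing` are those of `ℤ[t]`, so the general identity at the
-- indeterminate is the claim by computation.
mainTheorem6 (suc n) _ = NarayanaHankel.det-narayanaHankel IntegerPolynomials.polynomialRing t n
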